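{- Let $X$ be a set of variables. Every recognisable set of graphs over $X$ is regular; that is, for every Petri automaton $\mathcal A$ over the alphabet $\overline X$ there exists an expression $e$ over $X$ such that $\mathcal G(e)=\{\,\overline{\,G\,}\mid G\in\mathcal G(\mathcal A)\}$, where $G\mapsto\overline{\,G\,}$ is the operation from graphs over $\overline X$ to graphs over $X$ defined in the context.
   Context: A graph over a set $Y$ is a tuple $\langle V,E,\iota,o\rangle$ with $V$ finite, $E\subseteq V\times Y\times V$, and $\iota,o\in V$ (input, output); graphs are considered up to isomorphism. Expressions over $X$: $e,f ::= e\cup f \mid e\cdot f\mid e\cap f\mid e^+\mid e^{\circ}\mid 0\mid 1\mid\top\mid a$ ($a\in X$); terms are those without $0,\cup,{}^+$. The set of terms $T(e)$: $T(e\cdot f)=\{u\cdot v\mid u\in T(e),v\in T(f)\}$, $T(e\cap f)=\{u\cap v\mid u\in T(e),v\in T(f)\}$, $T(e^\circ)=\{u^\circ\mid u\in T(e)\}$, $T(e\cup f)=T(e)\cup T(f)$, $T(e^+)=\bigcup_{n>0}\{u_1\cdots u_n\mid u_i\in T(e)\}$, $T(0)=\emptyset$, $T(1)=\{1\}$, $T(\top)=\{\top\}$, $T(a)=\{a\}$. Graph of a term: $\mathcal G(a)$ is a single $a$-labelled edge from input to (distinct) output; $\mathcal G(u\cdot v)$ merges the output of $\mathcal G(u)$ with the input of $\mathcal G(v)$; $\mathcal G(u\cap v)$ merges inputs and merges outputs; $\mathcal G(u^\circ)$ swaps input and output; $\mathcal G(1)$ is a single vertex (input and output), no edge; $\mathcal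 G(\top)$ is two vertices (input and output), no edge. $\mathcal G(e)=\{\mathcal G(u)\mid u\in T(e)\}$. A set of graphs over $X$ is regular if it equals $\mathcal G(e)$ for some expression $e$. $\overline X= X\cup\{a'\mid a\in X\}\cup\{1,\top\}$ (disjoint union of formal letters). For a graph $G=\langle V,E,\iota,o\rangle$ over $\overline X$, let $\equiv$ be the smallest equivalence relation on $V$ containing all $(i,j)$ with $(i,1,j)\in E$; then $\overline{\,G\,}=\langle V/{\equiv},E',[\iota],[o]\rangle$ with $E'=\{([i],x,[j])\mid x\in X,\ \exists (k,l)\in[i]\times[j]:(k,x,l)\in E\text{ or }(l,x',k)\in E\}$. A set $S$ of graphs over $X$ is recognisable if there is a Petri automaton $\mathcal A$ over $\overline X$ with $S=\{\overline{\,G\,}\mid G\in\mathcal G(\mathcal A)\}$. Series-parallel graphs: on graphs with edges labelled by formal terms built from letters with $\cdot$ and $\cap$, the SP-rewriting system has two rules: (parallel) replace two edges $(x,u,y),(x,v,y)$ by $(x,u\cap v,y)$; (series) if $w$ is neither the input nor the output and its only adjacent edges are $(x,u,w)$ and $(w,v,y)$, delete $w$ and these edges and add $(x,u\cdot v,y)$. A graph is series-parallel if it rewrites to a graph consisting of two distinct vertices, the input and the output, and exactly one edge, from input to output. A Petri automaton over an alphabet $Y$ is $\mathcal A=\langle P,\mathcal T,\iota\rangle$ with $P$ a finite set of places, $\mathcal T\subseteq\mathcal P(P)\times\mathcal P(Y\times P)$ a finite set of transitions $t=\langle \mathrm{in}(t),\mathrm{out}(t)\rangle$ with $\mathrm{in}(t)\neq\emptyset$,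 each $\mathrm{out}(t)$ being finite, and $\iota\in P$, subject to the two constraints below. Let $\pi_2(\mathrm{out}(t))=\{p\mid\exists a,(a,p)\in\mathrm{out}(t)\}$. A state is a set $S\subseteq P$; $t$ is enabled in $S$ if $\mathrm{in}(t)\subseteq S$, and firing it leads to $(S\setminus\mathrm{in}(t))\cup\pi_2(\mathrm{out}(t))$. A run is a sequence $t_0;\dots;t_n$ of successively fired transitions; it is accepting if it goes from $\{\iota\}$ to $\emptyset$. A state is reachable if there is a run to it from $\{\iota\}$. The trace of an accepting run $t_0;\dots;t_n$ is the graph with vertices $\{0,\dots,n\}$, input $0$, output $n$, and edges $(k,a,l)$ whenever there is $(a,p)\in\mathrm{out}(t_k)$ with $l=\min\{l'>k\mid p\in\mathrm{in}(t_{l'})\}$. $\mathcal G(\mathcal A)$ is the set of traces of accepting runs. Constraint 1 (safety): whenever $t$ is enabled in a reachable state $S$, $(S\setminus\mathrm{in}(t))\cap\pi_2(\mathrm{out}(t))=\emptyset$. Constraint 2: every graph in $\mathcal G(\mathcal A)$ is series-parallel. -}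

module Defs where

open import Data.Fin.Base using (Fin; zero; suc; fromℕ; _≤_; _<_)
open import Data.Fin.Subset as Subset
  using (Subset; Nonempty; Empty; ⁅_⁆; ⋃; _─_)
open import Data.List.Base using (List; map; allFin; _++_)
open import Data.List.Membership.Propositional using (_∈_)
open import Data.List.Membership.Propositional.Properties using (∈-allFin)
open import Data.List.NonEmpty using (List⁺; foldr₁)
open import Data.List.NonEmpty.Relation.Unary.All using (All)
open import Data.List.Relation.Unary.Any as Any using ()
open import Data.List.Relation.Unary.Enumerates.Setoid using (IsEnumeration)
open import Data.List.Relation.Unary.Enumerates.Setoid.Properties using (++⁺)
open import Data.Nat.Base using (ℕ; suc)
open import Data.Product.Base using (∃; ∃₂; _×_; _,_; proj₁; proj₂)
open import Data.Sum.Base using (_⊎_; inj₁; inj₂)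
open import Data.Sum.Relation.Binary.Pointwise using (_⊎ₛ_; inj₁; inj₂)
import Data.Empty as Empty
open import Data.Vec.Base using (Vec; []; _∷_; lookup)
open import Function.Base using (_∘_)
open import Function.Bundles using (_⇔_; Inverse; Injection)
open import Level using (Level; 0ℓ; _⊔_) renaming (suc to lsuc)
open import Relation.Binary.Bundles using (Setoid)
open import Relation.Binary.Construct.Closure.Equivalence as EqClosure
  using (EqClosure)
import Relation.Binary.Construct.Closure.ReflexiveTransitive as Star
open Star using (Star)
import Relation.Binary.Construct.Closure.Symmetric as SymClosure
import Relation.Binary.Construct.Union as Union
open import Relation.Binary.Core using (Rel)
open import Relation.Binary.PropositionalEquality as ≡
  using (_≡_; _≢_; refl)
open import Relation.Nullary.Negation using (¬_)
open import Relation.Unary using (Pred; _⊆_; _≐_)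

private
  variable
    ℓ     : Level
    X Y Z : Set

-- The vertex set is a setoid, so that quotients of the vertex set are
-- available; all notions below are up to its equality.

record Graph (Y : Set) : Set₁ where
  field
    V : Setoid 0ℓ 0ℓ

  open Setoid V public
    using (_≈_; _≉_)
    renaming (Carrier to Vertex; refl to ≈-refl; sym to ≈-sym; trans to ≈-trans)

  field
    vertices : List Vertex
    finite   : IsEnumeration V vertices
    E        : Vertex → Y → Vertex → Set
    E-resp   : ∀ {i i′ a j j′} → i ≈ i′ → j ≈ j′ → E i a j → E i′ a j′
    ι o      : Vertex

  SameEdge : (Vertex × Y × Vertex) → (Vertex × Y × Vertex) → Set
  SameEdge (i , a , j) (k , b , l) = i ≈ k × a ≡ b × j ≈ l

infix 4 _≅_

record _≅_ (G H : Graph Y) : Set where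
  private
    module G = Graph G
    module H = Graph H
  field
    vertex-iso : Inverse G.V H.V
  open Inverse vertex-iso public using (to; from)
  field
    edges  : ∀ i a j → G.E i a j ⇔ H.E (to i) a (to j)
    input  : to G.ι H.≈ H.ι
    output : to G.o H.≈ H.o

-- Quotient of G by the smallest equivalence relation containing R.

infixl 6 _/_

_/_ : (G : Graph Y) → Rel (Graph.Vertex G) 0ℓ → Graph Y
G / R = record
  { V        = EqClosure.setoid R₌
  ; vertices = vertices
  ; finite   = λ v → Any.map (λ v≈w → SymClosure.fwd (inj₁ v≈w) Star.◅ Star.ε) (finite v)
  ; E        = λ i a j → ∃₂ λ k l → i ∼ k × j ∼ l × E k a l
  ; E-resp   = λ i∼i′ j∼j′ (k , l , i∼k , j∼l , e) →
                 k , l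
                 , EqClosure.transitive R₌ (EqClosure.symmetric R₌ i∼i′) i∼k
                 , EqClosure.transitive R₌ (EqClosure.symmetric R₌ j∼j′) j∼l
                 , e
  ; ι        = ι
  ; o        = o
  }
  where
  open Graph G
  R₌ _∼_ : Rel Vertex 0ℓ
  R₌  = _≈_ Union.∪ R
  _∼_ = EqClosure R₌

finGraph : ∀ {n} → (Fin n → Y → Fin n → Set) → Fin n → Fin n → Graph Y
finGraph {n = n} E ι o = record
  { V        = ≡.setoid (Fin n)
  ; vertices = allFin n
  ; finite   = ∈-allFin
  ; E        = E
  ; E-resp   = λ { refl refl e → e }
  ; ι        = ι
  ; o        = o
  }

module _ (G H : Graph Y) where
  private
    module G = Graph G
    module H = Graph H

  data DisjointEdge : G.Vertex ⊎ H.Vertex → Y → G.Vertex ⊎ H.Vertex → Set where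
    left  : ∀ {i a j} → G.E i a j → DisjointEdge (inj₁ i) a (inj₁ j)
    right : ∀ {i a j} → H.E i a j → DisjointEdge (inj₂ i) a (inj₂ j)

  disjointUnion : (ι o : G.Vertex ⊎ H.Vertex) → Graph Y
  disjointUnion ι o = record
    { V        = G.V ⊎ₛ H.V
    ; vertices = map inj₁ G.vertices ++ map inj₂ H.vertices
    ; finite   = ++⁺ G.V H.V G.finite H.finite
    ; E        = DisjointEdge
    ; E-resp   = λ { (inj₁ p) (inj₁ q) (left e)  → left (G.E-resp p q e)
                   ; (inj₂ p) (inj₂ q) (right e) → right (H.E-resp p q e)
                   }
    ; ι        = ι
    ; o        = o
    }

  data SeriesGlue : Rel (G.Vertex ⊎ H.Vertex) 0ℓ where
    middle : SeriesGlue (inj₁ G.o) (inj₂ H.ι)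

  data ParallelGlue : Rel (G.Vertex ⊎ H.Vertex) 0ℓ where
    inputs  : ParallelGlue (inj₁ G.ι) (inj₂ H.ι)
    outputs : ParallelGlue (inj₁ G.o) (inj₂ H.o)

  seriesComp : Graph Y
  seriesComp = disjointUnion (inj₁ G.ι) (inj₂ H.o) / SeriesGlue

  parallelComp : Graph Y
  parallelComp = disjointUnion (inj₁ G.ι) (inj₁ G.o) / ParallelGlue

swap : Graph Y → Graph Y
swap G = record { Graph G ; ι = Graph.o G ; o = Graph.ι G }

infixr 7 _·_
infixr 6 _∩_
infixr 5 _∪_
infix  8 _° _⁺

data Term (X : Set) : Set where
  var     : X → Term X
  _·_ _∩_ : Term X → Term X → Term X
  _°      : Term X → Term X
  𝟙 ⊤     : Term X

data Expr (X : Set) : Set where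
  var         : X → Expr X
  _∪_ _·_ _∩_ : Expr X → Expr X → Expr X
  _⁺ _°       : Expr X → Expr X
  𝟘 𝟙 ⊤       : Expr X

T : Expr X → Pred (Term X) 0ℓ
T (var a) w = w ≡ var a
T (e ∪ f) w = T e w ⊎ T f w
T (e · f) w = ∃₂ λ u v → T e u × T f v × w ≡ u · v
T (e ∩ f) w = ∃₂ λ u v → T e u × T f v × w ≡ u ∩ v
T (e ⁺)   w = ∃ λ (us : List⁺ (Term _)) → All (T e) us × w ≡ foldr₁ _·_ us
T (e °)   w = ∃ λ u → T e u × w ≡ u °
T 𝟘       w = Empty.⊥
T 𝟙       w = w ≡ 𝟙
T ⊤       w = w ≡ ⊤

data SingleEdge (a : Y) : Fin 2 → Y → Fin 2 → Set where
  edge : SingleEdge a zero a (suc zero)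

termGraph : Term X → Graph X
termGraph (var a) = finGraph (SingleEdge a) zero (suc zero)
termGraph (u · v) = seriesComp (termGraph u) (termGraph v)
termGraph (u ∩ v) = parallelComp (termGraph u) (termGraph v)
termGraph (u °)   = swap (termGraph u)
termGraph 𝟙       = finGraph {n = 1} (λ _ _ _ → Empty.⊥) zero zero
termGraph ⊤       = finGraph {n = 2} (λ _ _ _ → Empty.⊥) zero (suc zero)

-- Graphs are considered up to isomorphism, so every set of graphs defined
-- below is closed under _≅_.

𝒢 : Expr X → Pred (Graph X) 0ℓ
𝒢 e G = ∃ λ u → T e u × G ≅ termGraph u

Regular : Pred (Graph X) ℓ → Set (lsuc 0ℓ ⊔ ℓ)
Regular {X} S = ∃ λ (e : Expr X) → S ≐ 𝒢 e

data SPTerm (Y : Set) : Set where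
  var     : Y → SPTerm Y
  _·_ _∩_ : SPTerm Y → SPTerm Y → SPTerm Y

mapLabels : (Y → Z) → Graph Y → Graph Z
mapLabels f G = record
  { V        = V
  ; vertices = vertices
  ; finite   = finite
  ; E        = λ i b j → ∃ λ a → b ≡ f a × E i a j
  ; E-resp   = λ i≈i′ j≈j′ (a , b≡fa , e) → a , b≡fa , E-resp i≈i′ j≈j′ e
  ; ι        = ι
  ; o        = o
  }
  where open Graph G

-- G and H range over representatives of isomorphism classes: H is any
-- graph isomorphic to the result of rewriting G.  Edges form a set, so
-- two edges with the same endpoints are distinct when their labels are.

record ParallelStep (G H : Graph (SPTerm Y)) : Set where
  private
    module G = Graph G
    module H = Graph H
  field
    x y     : G.Vertex
    u v     : SPTerm Y
    u≢v     : u ≢ v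
    x-u-y   : G.E x u y
    x-v-y   : G.E x v y
    -- H has the vertices of G, up to the bijection vertex-iso.
    vertex-iso : Inverse G.V H.V
  open Inverse vertex-iso public using (to)
  field
    input   : to G.ι H.≈ H.ι
    output  : to G.o H.≈ H.o
    edges   : ∀ i a j → H.E (to i) a (to j) ⇔
                ( (G.E i a j
                   × ¬ G.SameEdge (i , a , j) (x , u , y)
                   × ¬ G.SameEdge (i , a , j) (x , v , y))
                ⊎ G.SameEdge (i , a , j) (x , u ∩ v , y))

record SeriesStep (G H : Graph (SPTerm Y)) : Set where
  private
    module G = Graph G
    module H = Graph H
  field
    w       : G.Vertex
    w≉ι     : w G.≉ G.ι
    w≉o     : w G.≉ G.o
    -- H has the vertices of G other than w, up to the injection embed.
    embed   : Injection H.V G.V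
  open Injection embed public using (to)
  field
    image   : ∀ i → (∃ λ h → to h G.≈ i) ⇔ i G.≉ w
    input   : to H.ι G.≈ G.ι
    output  : to H.o G.≈ G.o
    x y     : H.Vertex
    u v     : SPTerm Y
    into-w  : ∀ i a → G.E i a w ⇔ (i G.≈ to x × a ≡ u)
    from-w  : ∀ a j → G.E w a j ⇔ (a ≡ v × j G.≈ to y)
    edges   : ∀ i a j → H.E i a j ⇔
                (G.E (to i) a (to j) ⊎ H.SameEdge (i , a , j) (x , u · v , y))

_⇝_ : Rel (Graph (SPTerm Y)) 0ℓ
G ⇝ H = ParallelStep G H ⊎ SeriesStep G H

record IsSingleEdge (G : Graph Y) : Set where
  open Graph G
  field
    ι≉o       : ι ≉ o
    only-ι-o  : ∀ i → i ≈ ι ⊎ i ≈ o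
    label     : Y
    only-edge : ∀ i a j → E i a j ⇔ SameEdge (i , a , j) (ι , label , o)

SeriesParallel : Pred (Graph Y) (lsuc 0ℓ)
SeriesParallel G = ∃ λ H → Star _⇝_ (mapLabels var G) H × IsSingleEdge H

π₂ : ∀ {n} → List (Y × Fin n) → Subset n
π₂ = ⋃ ∘ map (⁅_⁆ ∘ proj₂)

record Transition (Y : Set) (n : ℕ) : Set where
  field
    pre      : Subset n
    post     : List (Y × Fin n)
    nonempty : Nonempty pre

-- Petri automata without the two constraints.

record PetriNet (Y : Set) : Set where
  field
    #places     : ℕ
    transitions : List (Transition Y #places)
    ι           : Fin #places

  Place State : Set
  Place = Fin #places
  State = Subset #places

  open Transition public

  Enabled : Transition Y #places → State → Set
  Enabled t S = pre t Subset.⊆ S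

  fire : Transition Y #places → State → State
  fire t S = (S ─ pre t) Subset.∪ π₂ (post t)

  data Run : ∀ {n} → State → Vec (Transition Y #places) n → State → Set where
    []  : ∀ {S} → Run S [] S
    _∷_ : ∀ {n S S′ t} {ts : Vec _ n} →
          t ∈ transitions × Enabled t S → Run (fire t S) ts S′ → Run S (t ∷ ts) S′

  Accepting : ∀ {n} → Vec (Transition Y #places) n → Set
  Accepting ts = Run ⁅ ι ⁆ ts Subset.⊥

  Reachable : Pred State 0ℓ
  Reachable S = ∃₂ λ n (ts : Vec _ n) → Run ⁅ ι ⁆ ts S

  NextConsumer : ∀ {n} → Vec (Transition Y #places) n → Fin n → Place → Fin n → Set
  NextConsumer ts k p l =
    Consumes l × (∀ l′ → Consumes l′ → l ≤ l′)
    where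
    Consumes : Fin _ → Set
    Consumes l′ = k < l′ × p Subset.∈ pre (lookup ts l′)

  trace : ∀ {n} → Vec (Transition Y #places) (suc n) → Graph Y
  trace {n} ts = finGraph
    (λ k a l → ∃ λ p → (a , p) ∈ post (lookup ts k) × NextConsumer ts k p l)
    zero (fromℕ n)

  traces : Pred (Graph Y) 0ℓ
  traces G = ∃₂ λ n (ts : Vec _ (suc n)) → Accepting ts × G ≅ trace ts

record PetriAutomaton (Y : Set) : Set₁ where
  field
    net : PetriNet Y
  open PetriNet net public
  field
    safe : ∀ {S t} → Reachable S → t ∈ transitions → Enabled t S →
           Empty ((S ─ pre t) Subset.∩ π₂ (post t))
    series-parallel : traces ⊆ SeriesParallel

data Ext (X : Set) : Set where
  letter : X → Ext X
  _′     : X → Ext X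
  𝟙 ⊤    : Ext X

-- Edges labelled 𝟙 only contribute to the quotient and edges labelled ⊤
-- are dropped.

overline : Graph (Ext X) → Graph X
overline G = G↾X / λ i j → E i 𝟙 j
  where
  open Graph G
  G↾X : Graph _
  G↾X = record
    { V        = V
    ; vertices = vertices
    ; finite   = finite
    ; E        = λ i x j → E i (letter x) j ⊎ E j (x ′) i
    ; E-resp   = λ { i≈i′ j≈j′ (inj₁ e) → inj₁ (E-resp i≈i′ j≈j′ e)
                   ; i≈i′ j≈j′ (inj₂ e) → inj₂ (E-resp j≈j′ i≈i′ e)
                   }
    ; ι        = ι
    ; o        = o
    }

overlines : Pred (Graph (Ext X)) 0ℓ → Pred (Graph X) (lsuc 0ℓ)
overlines S H = ∃ λ G → S G × H ≅ overline G

Recognisable : Pred (Graph X) ℓ → Set (lsuc 0ℓ ⊔ ℓ)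
Recognisable {X} S = ∃ λ (𝒜 : PetriAutomaton (Ext X)) →
  S ≐ overlines (PetriAutomaton.traces 𝒜)

{-# OPTIONS --safe #-}
module Submission where

-- The vertices of a trace are the transitions of the run, its edges the tokens.
-- A series-parallel part of a trace leads from tokens A to tokens B and is a
-- single bundle of tokens, a series of parts joined at transitions, or two
-- parallel parts.  Along an SP-rewriting every edge abbreviates such a part, so
-- the trace of an accepting run is one.  Conversely, safety lets the transitions
-- of any abstract part fire next to idle tokens, so every part is that of a run.
-- For bounded parallel depth the parts from A to B have a regular expression: by
-- recursion on the depth for parallel parts, and by Kleene's construction, with
-- transitions as the states, for series.  The depth is at most the number of
-- places, because each parallel level leaves one more token idle.

open import Defs
import Data.Bool.Properties as Bool
import Data.Empty as Empty
import Data.Fin.Properties as Fin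
import Data.List.NonEmpty.Relation.Unary.All as All⁺
import Data.Nat.Properties as ℕ
open All⁺ using (_∷_)
open Empty using (⊥-elim)
open import Data.Bool.Base using (if_then_else_; _∧_)
open import Data.Fin.Base using (Fin; zero; suc; toℕ; fromℕ; opposite; _≤_; _<_)
open import Data.Fin.Induction using (<-wellFounded)
open import Data.Fin.Subset as Subset using (Subset; Nonempty; ⁅_⁆; _─_; ∣_∣; inside; outside)
open import Data.Fin.Subset.Properties
open import Data.List.Base as List using (List; []; _∷_; length; cartesianProduct)
open import Data.List.Membership.Propositional using (_∈_)
open import Data.List.Membership.Propositional.Properties
  using (∈-++⁺ˡ; ∈-++⁺ʳ; ∈-map⁺; ∈-cartesianProduct⁺; ∈-cartesianProduct⁻)
open import Data.List.NonEmpty.Base using (_∷_; foldr₁)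
open import Data.List.Relation.Unary.All as All using (All; []; _∷_)
open import Data.List.Relation.Unary.All.Properties using (++⁺)
open import Data.List.Relation.Unary.Any using (here; there)
open import Data.Nat.Base as ℕ using (ℕ; z≤n; s≤s; z<s; s<s)
open import Data.Product.Base using (∃; ∃₂; _×_; _,_; proj₁; proj₂; map₂)
open import Data.Sum.Base as Sum using (_⊎_; inj₁; inj₂)
open import Data.Sum.Relation.Binary.Pointwise using (inj₁; inj₂)
open import Data.Unit.Base using (tt) renaming (⊤ to Unit)
open import Data.Vec.Base using (Vec; []; _∷_; lookup; _++_; here; there; tabulate; fromList)
open import Data.Vec.Properties using (lookup∘tabulate; []=⇒lookup; lookup⇒[]=; ≡-dec)
open import Function.Base using (_∘_; id; case_of_)
open import Function.Bundles using (_⇔_; mk⇔; Equivalence; Inverse; Injection)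
open import Induction.WellFounded using (Acc; acc)
open import Level using (0ℓ)
open import Relation.Binary.Bundles using (Setoid)
open import Relation.Binary.Construct.Closure.Equivalence as EqClosure using (EqClosure)
open import Relation.Binary.Construct.Closure.ReflexiveTransitive using (Star; ε; _◅_)
open import Relation.Binary.Construct.Closure.Symmetric using (fwd; bwd)
open import Relation.Binary.Core using (Rel)
open import Relation.Binary.PropositionalEquality using (_≡_; _≢_; refl; sym; trans; subst; cong)
open import Relation.Binary.Structures using (IsEquivalence)
open import Relation.Nullary using (¬_; Dec; yes; no; does; contradiction)
open import Relation.Nullary.Decidable using (_×-dec_; _→-dec_; dec-true; ¬?; map′)
open import Relation.Unary using (Pred; Decidable; _≐_)

-- Series and parallel composition are associative only up to isomorphism, so the term that
-- SP-rewriting yields is in general not a term of the expression. Terms are therefore compared only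
-- through their graphs: whatever its bracketing, a block spanning an accepting run has the
-- overlined trace as its graph (`Block⇒≅`). For one inclusion the block is bracketed anew on the
-- same run until its term fits the expression (`flatten`). For the other, a term of the expression
-- is read as a flow and a run is built for it, with an arbitrary choice of interleaving.
--
-- An expression knows transitions and sets of tokens, but no positions in a run. What makes parts
-- portable is that an inner transition takes exactly the tokens of the part before it and hands all
-- of its output to the part after it. Safety then gives two separations: parallel parts meet only
-- at their ends, because each token has a single producer, and the output of a part never falls on
-- the idle tokens beside it.

private
  variable
    X Y : Set

-- Isomorphisms

≅-refl : {G : Graph Y} → G ≅ G
≅-refl {G = G} = record
  { vertex-iso = record
    { to = id ; from = id ; to-cong = id ; from-cong = id ; inverse = id , id }
  ; edges  = λ _ _ _ → mk⇔ id id
  ; input  = Graph.≈-refl G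
  ; output = Graph.≈-refl G
  }

≅-sym : {G H : Graph Y} → G ≅ H → H ≅ G
≅-sym {G = G} {H} G≅H = record
  { vertex-iso = record
    { to = I.from ; from = I.to ; to-cong = I.from-cong ; from-cong = I.to-cong
    ; inverse = I.inverseʳ , I.inverseˡ }
  ; edges  = λ i a j → mk⇔
      (λ e → Equivalence.from (edges _ a _)
               (H.E-resp (H.≈-sym (I.strictlyInverseˡ i)) (H.≈-sym (I.strictlyInverseˡ j)) e))
      (λ e → H.E-resp (I.strictlyInverseˡ i) (I.strictlyInverseˡ j)
               (Equivalence.to (edges _ a _) e))
  ; input  = I.inverseʳ (H.≈-sym input)
  ; output = I.inverseʳ (H.≈-sym output)
  }
  where
  open _≅_ G≅H using (vertex-iso; edges; input; output)
  module I = Inverse vertex-iso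
  module H = Graph H

≅-trans : {G H K : Graph Y} → G ≅ H → H ≅ K → G ≅ K
≅-trans {G = G} {H} {K} G≅H H≅K = record
  { vertex-iso = record
    { to = J.to ∘ I.to ; from = I.from ∘ J.from
    ; to-cong = J.to-cong ∘ I.to-cong ; from-cong = I.from-cong ∘ J.from-cong
    ; inverse = J.inverseˡ ∘ I.inverseˡ , I.inverseʳ ∘ J.inverseʳ }
  ; edges  = λ i a j → mk⇔
      (Equivalence.to (H≅K.edges _ a _) ∘ Equivalence.to (G≅H.edges i a j))
      (Equivalence.from (G≅H.edges i a j) ∘ Equivalence.from (H≅K.edges _ a _))
  ; input  = Graph.≈-trans K (J.to-cong G≅H.input) H≅K.input
  ; output = Graph.≈-trans K (J.to-cong G≅H.output) H≅K.output
  }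
  where
  module G≅H = _≅_ G≅H
  module H≅K = _≅_ H≅K
  module I = Inverse G≅H.vertex-iso
  module J = Inverse H≅K.vertex-iso

overline-cong : {G H : Graph (Ext X)} → G ≅ H → overline G ≅ overline H
overline-cong {G = G} {H} G≅H = record
  { vertex-iso = record
    { to = I.to ; from = I.from
    ; to-cong   = to-cong
    ; from-cong = from-cong
    ; inverse = (λ {j} eq → H̄.trans (to-cong eq) (embH (I.strictlyInverseˡ j)))
              , (λ {i} eq → Ḡ.trans (from-cong eq) (embG (I.strictlyInverseʳ i))) }
  ; edges  = λ i a j → mk⇔
      (λ (k , l , p , q , e) → I.to k , I.to l , to-cong p , to-cong q , to-edge e)
      (λ (k , l , p , q , e) → I.from k , I.from l
        , Ḡ.trans (embG (G.≈-sym (I.strictlyInverseʳ i))) (from-cong p)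
        , Ḡ.trans (embG (G.≈-sym (I.strictlyInverseʳ j))) (from-cong q) , from-edge e)
  ; input  = embH input
  ; output = embH output
  }
  where
  open _≅_ G≅H using (vertex-iso; edges; input; output)
  module I = Inverse vertex-iso
  module G = Graph G
  module H = Graph H
  module H̄ = Setoid (Graph.V (overline H))
  module Ḡ = Setoid (Graph.V (overline G))
  embG : ∀ {i j} → i G.≈ j → Graph._≈_ (overline G) i j
  embG p = EqClosure.return (inj₁ p)
  embH : ∀ {i j} → i H.≈ j → Graph._≈_ (overline H) i j
  embH p = EqClosure.return (inj₁ p)
  back : ∀ {i a j} → H.E i a j → G.E (I.from i) a (I.from j)
  back {i} {a} {j} e = Equivalence.from (edges _ a _)
    (H.E-resp (H.≈-sym (I.strictlyInverseˡ i)) (H.≈-sym (I.strictlyInverseˡ j)) e)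
  to-cong : ∀ {i j} → Graph._≈_ (overline G) i j → Graph._≈_ (overline H) (I.to i) (I.to j)
  to-cong = EqClosure.gmap I.to (Sum.map I.to-cong (Equivalence.to (edges _ _ _)))
  from-cong : ∀ {i j} → Graph._≈_ (overline H) i j → Graph._≈_ (overline G) (I.from i) (I.from j)
  from-cong = EqClosure.gmap I.from (Sum.map I.from-cong back)
  to-edge : ∀ {i x j} → G.E i (letter x) j ⊎ G.E j (x ′) i →
            H.E (I.to i) (letter x) (I.to j) ⊎ H.E (I.to j) (x ′) (I.to i)
  to-edge = Sum.map (Equivalence.to (edges _ _ _)) (Equivalence.to (edges _ _ _))
  from-edge : ∀ {i x j} → H.E i (letter x) j ⊎ H.E j (x ′) i →
              G.E (I.from i) (letter x) (I.from j) ⊎ G.E (I.from j) (x ′) (I.from i)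
  from-edge = Sum.map back back

-- Presentations of term graphs

letterTerm : Ext X → Term X
letterTerm (letter x) = var x
letterTerm (x ′)      = var x °
letterTerm 𝟙          = 𝟙
letterTerm ⊤          = ⊤

XEdge : {V : Set} → (V → Ext X → V → Set) → V → X → V → Set
XEdge Ed i a j = Ed i (letter a) j ⊎ Ed j (a ′) i

-- A representation of termGraph u as the quotient of the graph on the
-- vertices Sc with edges Ed, input x and output y, by its 𝟙-edges:
-- F v i says that i belongs to the class v.

record Rep {V : Set} (x y : V) (Sc : V → Set) (Ed : V → Ext X → V → Set) (u : Term X) : Set₁ where
  open Graph (termGraph u) public hiding (V)
  field
    F      : Vertex → V → Set
    total  : ∀ v → ∃ λ i → F v i
    scope  : ∀ {v i} → F v i → Sc i
    hits   : ∀ {i} → Sc i → ∃ λ v → F v i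
    F-ι    : F ι x
    F-o    : F o y
    inj    : ∀ {v v′ i} → F v i → F v′ i → v ≈ v′
    -- Every equivalence containing the 𝟙-edges is allowed, so that this field of a part still
    -- applies inside a whole with more 𝟙-edges.
    identify   : ∀ {_∼_ : Rel V 0ℓ} → IsEquivalence _∼_ → (∀ {i j} → Ed i 𝟙 j → i ∼ j) →
             ∀ {v v′ i j} → v ≈ v′ → F v i → F v′ j → i ∼ j
    glue   : ∀ {i j} → Ed i 𝟙 j → ∃₂ λ v v′ → F v i × F v′ j × v ≈ v′
    edges→ : ∀ {v a v′} → E v a v′ → ∃₂ λ k l → ∃₂ λ i j →
             v ≈ k × v′ ≈ l × F k i × F l j × XEdge Ed i a j
    edges← : ∀ {i a j} → XEdge Ed i a j → ∃₂ λ v v′ → F v i × F v′ j × E v a v′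

module _ {V : Set} {x y : V} where

  Rep-map : ∀ {Sc Sc′} {Ed Ed′ : V → Ext X → V → Set} {u} →
            (∀ {i} → Sc i ⇔ Sc′ i) → (∀ {i a j} → Ed i a j ⇔ Ed′ i a j) →
            Rep x y Sc Ed u → Rep x y Sc′ Ed′ u
  Rep-map sc ed R = record
    { F = F ; total = total
    ; scope = λ f → Equivalence.to sc (scope f)
    ; hits  = λ s → hits (Equivalence.from sc s)
    ; F-ι = F-ι ; F-o = F-o ; inj = inj
    ; identify = λ eq one → identify eq (λ e → one (Equivalence.to ed e))
    ; glue = λ e → glue (Equivalence.from ed e)
    ; edges→ = λ e → let (k , l , i , j , p , q , f , g , e′) = edges→ e in
        k , l , i , j , p , q , f , g
        , Sum.map (Equivalence.to ed) (Equivalence.to ed) e′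
    ; edges← = λ e → edges← (Sum.map (Equivalence.from ed) (Equivalence.from ed) e)
    }
    where open Rep R

  Ends : V → Set
  Ends i = i ≡ x ⊎ i ≡ y

  Rep-⊤ : x ≢ y → Rep {X} x y Ends (λ _ _ _ → Empty.⊥) ⊤
  Rep-⊤ x≢y = record
    { F = F ; total = λ { zero → x , refl ; (suc zero) → y , refl }
    ; scope = λ { {zero} → inj₁ ; {suc zero} → inj₂ }
    ; hits = λ { (inj₁ p) → zero , p ; (inj₂ p) → suc zero , p }
    ; F-ι = refl ; F-o = refl
    ; inj = inj
    ; identify = λ { eq _ {v} refl p q → IsEquivalence.reflexive eq (func v p q) }
    ; glue = λ ()
    ; edges→ = λ ()
    ; edges← = λ { (inj₁ ()) ; (inj₂ ()) }
    }
    where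
    F : Fin 2 → V → Set
    F zero       i = i ≡ x
    F (suc zero) i = i ≡ y
    func : ∀ v {i j} → F v i → F v j → i ≡ j
    func zero       p q = trans p (sym q)
    func (suc zero) p q = trans p (sym q)
    inj : ∀ {v v′ i} → F v i → F v′ i → v ≡ v′
    inj {zero} {zero} p q = refl
    inj {zero} {suc zero} refl refl = ⊥-elim (x≢y refl)
    inj {suc zero} {zero} refl refl = ⊥-elim (x≢y refl)
    inj {suc zero} {suc zero} p q = refl

  LetterEdge : Ext X → V → Ext X → V → Set
  LetterEdge a i b j = i ≡ x × b ≡ a × j ≡ y

  Rep-letter : x ≢ y → (a : Ext X) → Rep x y Ends (LetterEdge a) (letterTerm a)
  Rep-letter {X} x≢y ⊤ = record
    { F = F ; total = total ; scope = λ {v} → scope {v} ; hits = hits ; F-ι = F-ι ; F-o = F-o ; inj = inj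
    ; identify = λ eq _ → identify eq (λ ()) ; glue = λ { (_ , () , _) }
    ; edges→ = λ () ; edges← = λ { (inj₁ (_ , () , _)) ; (inj₂ (_ , () , _)) }
    }
    where open Rep (Rep-⊤ {X} x≢y)
  Rep-letter {X} x≢y (letter a) = record
    { F = F ; total = total ; scope = λ {v} → scope {v} ; hits = hits ; F-ι = F-ι ; F-o = F-o ; inj = inj
    ; identify = λ eq _ → identify eq (λ ()) ; glue = λ { (_ , () , _) }
    ; edges→ = λ { edge → _ , _ , _ , _ , refl , refl , refl , refl , inj₁ (refl , refl , refl) }
    ; edges← = λ { (inj₁ (refl , refl , refl)) → zero , suc zero , refl , refl , edge
                 ; (inj₂ (_ , () , _)) }
    }
    where open Rep (Rep-⊤ {X} x≢y)
  Rep-letter {X} x≢y (a ′) = record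
    { F = F ; total = total ; scope = λ {v} → scope {v} ; hits = hits ; F-ι = F-ι ; F-o = F-o ; inj = inj
    ; identify = λ eq _ → identify eq (λ ()) ; glue = λ { (_ , () , _) }
    ; edges→ = λ { edge → _ , _ , _ , _ , refl , refl , refl , refl , inj₂ (refl , refl , refl) }
    ; edges← = λ { (inj₂ (refl , refl , refl)) → zero , suc zero , refl , refl , edge
                 ; (inj₁ (_ , () , _)) }
    }
    where
    F : Fin 2 → V → Set
    -- `°` swaps input and output, so vertex 1 of the single edge now stands for `x`.
    F v = Rep.F (Rep-⊤ {X} x≢y) (opposite v)
    total : ∀ v → ∃ λ i → F v i
    total zero = y , refl
    total (suc zero) = x , refl
    scope : ∀ {v i} → F v i → Ends i
    scope {zero} = inj₂
    scope {suc zero} = inj₁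
    hits : ∀ {i} → Ends i → ∃ λ v → F v i
    hits (inj₁ p) = suc zero , p
    hits (inj₂ p) = zero , p
    F-ι : F (suc zero) x
    F-ι = refl
    F-o : F zero y
    F-o = refl
    inj : ∀ {v v′ i} → F v i → F v′ i → v ≡ v′
    inj {zero} {zero} p q = refl
    inj {zero} {suc zero} refl refl = ⊥-elim (x≢y refl)
    inj {suc zero} {zero} refl refl = ⊥-elim (x≢y refl)
    inj {suc zero} {suc zero} p q = refl
    identify : ∀ {_∼_ : Rel V 0ℓ} → IsEquivalence _∼_ → (∀ {i j} → Empty.⊥ → i ∼ j) →
           ∀ {v v′ i j} → v ≡ v′ → F v i → F v′ j → i ∼ j
    identify eq one {v} refl p q = Rep.identify (Rep-⊤ {X} x≢y) eq one {opposite v} {opposite v} refl p q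
  Rep-letter {X} x≢y 𝟙 = record
    -- The only class holds both ends, and the 𝟙-edge itself justifies identifying them.
    { F = λ _ → Ends
    ; total = λ _ → x , inj₁ refl
    ; scope = λ f → f
    ; hits = λ s → zero , s
    ; F-ι = inj₁ refl ; F-o = inj₂ refl
    ; inj = λ { {zero} {zero} _ _ → refl }
    ; identify = λ eq one _ p q → IsEquivalence.trans eq (end eq (one (refl , refl , refl)) p)
                                (IsEquivalence.sym eq (end eq (one (refl , refl , refl)) q))
    ; glue = λ { (refl , _ , refl) → zero , zero , inj₁ refl , inj₂ refl , refl }
    ; edges→ = λ ()
    ; edges← = λ { (inj₁ (_ , () , _)) ; (inj₂ (_ , () , _)) }
    }
    where
    end : ∀ {_∼_ : Rel V 0ℓ} → IsEquivalence _∼_ → x ∼ y → ∀ {i} → Ends i → i ∼ y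
    end eq x∼y (inj₁ refl) = x∼y
    end eq x∼y (inj₂ refl) = IsEquivalence.refl eq

module _ {V : Set} {Sc₁ Sc₂ : V → Set} {Ed₁ Ed₂ : V → Ext X → V → Set} {u v₀ : Term X} where

  private
    UEd : V → Ext X → V → Set
    UEd i a j = Ed₁ i a j ⊎ Ed₂ i a j

  module Glued {x₁ y₁ x₂ y₂ : V}
    (R : Rep x₁ y₁ Sc₁ Ed₁ u) (S : Rep x₂ y₂ Sc₂ Ed₂ v₀)
    (ι′ o′ : Rep.Vertex R ⊎ Rep.Vertex S)
    (Glue : Rel (Rep.Vertex R ⊎ Rep.Vertex S) 0ℓ)
    where

    private
      module R = Rep R
      module S = Rep S

    GG : Graph X
    GG = disjointUnion (termGraph u) (termGraph v₀) ι′ o′ / Glue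

    open Graph GG using (_≈_; ≈-refl; ≈-sym; ≈-trans; E)

    F : R.Vertex ⊎ S.Vertex → V → Set
    F (inj₁ v) i = R.F v i
    F (inj₂ v) i = S.F v i

    inl : ∀ {v v′} → v R.≈ v′ → inj₁ v ≈ inj₁ v′
    inl p = EqClosure.return (inj₁ (inj₁ p))

    inr : ∀ {v v′} → v S.≈ v′ → inj₂ v ≈ inj₂ v′
    inr p = EqClosure.return (inj₁ (inj₂ p))

    total : ∀ v → ∃ λ i → F v i
    total (inj₁ v) = R.total v
    total (inj₂ v) = S.total v

    scope : ∀ {v i} → F v i → Sc₁ i ⊎ Sc₂ i
    scope {inj₁ v} f = inj₁ (R.scope f)
    scope {inj₂ v} f = inj₂ (S.scope f)

    hits : ∀ {i} → Sc₁ i ⊎ Sc₂ i → ∃ λ v → F v i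
    hits (inj₁ s) = let (v , f) = R.hits s in inj₁ v , f
    hits (inj₂ s) = let (v , f) = S.hits s in inj₂ v , f

    inj : (∀ {v v′ i} → R.F v i → S.F v′ i → inj₁ v ≈ inj₂ v′) →
          ∀ {v v′ i} → F v i → F v′ i → v ≈ v′
    inj mixed {inj₁ v} {inj₁ v′} p q = inl (R.inj p q)
    inj mixed {inj₁ v} {inj₂ v′} p q = mixed p q
    inj mixed {inj₂ v} {inj₁ v′} p q = ≈-sym (mixed q p)
    inj mixed {inj₂ v} {inj₂ v′} p q = inr (S.inj p q)

    -- A path in the quotient is translated step by step: by `total` every class on it contains some
    -- vertex, and two glued classes share one, so gluing identifies nothing beyond the 𝟙-edges.
    identify : (∀ {v v′} → Glue v v′ → ∃ λ i → F v i × F v′ i) →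
           ∀ {_∼_ : Rel V 0ℓ} → IsEquivalence _∼_ → (∀ {i j} → UEd i 𝟙 j → i ∼ j) →
           ∀ {v v′ i j} → v ≈ v′ → F v i → F v′ j → i ∼ j
    identify common {_∼_} eq one = go
      where
      module ∼ = IsEquivalence eq
      F-func : ∀ {v i j} → F v i → F v j → i ∼ j
      F-func {inj₁ v} = R.identify eq (one ∘ inj₁) R.≈-refl
      F-func {inj₂ v} = S.identify eq (one ∘ inj₂) S.≈-refl
      step : ∀ {v v′ i j} → Graph._≈_ (disjointUnion (termGraph u) (termGraph v₀) ι′ o′) v v′ ⊎ Glue v v′ →
             F v i → F v′ j → i ∼ j
      step (inj₁ (inj₁ p)) = R.identify eq (one ∘ inj₁) p
      step (inj₁ (inj₂ p)) = S.identify eq (one ∘ inj₂) p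
      step {v} {v′} (inj₂ g) p q = let (k , r , s) = common g in ∼.trans (F-func {v} p r) (F-func {v′} s q)
      go : ∀ {v v′ i j} → v ≈ v′ → F v i → F v′ j → i ∼ j
      go {v} ε p q = F-func {v} p q
      go (_◅_ {j = k} (fwd s) t) p q = let (l , r) = total k in ∼.trans (step s p r) (go t r q)
      go (_◅_ {j = k} (bwd s) t) p q = let (l , r) = total k in ∼.trans (∼.sym (step s r p)) (go t r q)

    glue : ∀ {i j} → UEd i 𝟙 j → ∃₂ λ v v′ → F v i × F v′ j × v ≈ v′
    glue (inj₁ e) = let (v , v′ , f , g , p) = R.glue e in inj₁ v , inj₁ v′ , f , g , inl p
    glue (inj₂ e) = let (v , v′ , f , g , p) = S.glue e in inj₂ v , inj₂ v′ , f , g , inr p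

    edges→ : ∀ {v a v′} → E v a v′ → ∃₂ λ k l → ∃₂ λ i j →
             v ≈ k × v′ ≈ l × F k i × F l j × XEdge UEd i a j
    edges→ (_ , _ , p , q , left e) =
      let (k , l , i , j , p′ , q′ , f , g , e′) = R.edges→ e in
      inj₁ k , inj₁ l , i , j , ≈-trans p (inl p′) , ≈-trans q (inl q′) , f , g , Sum.map inj₁ inj₁ e′
    edges→ (_ , _ , p , q , right e) =
      let (k , l , i , j , p′ , q′ , f , g , e′) = S.edges→ e in
      inj₂ k , inj₂ l , i , j , ≈-trans p (inr p′) , ≈-trans q (inr q′) , f , g , Sum.map inj₂ inj₂ e′

    edges←₁ : ∀ {i a j} → XEdge Ed₁ i a j → ∃₂ λ v v′ → F v i × F v′ j × E v a v′
    edges←₁ e = let (v , v′ , f , g , e′) = R.edges← e in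
      inj₁ v , inj₁ v′ , f , g , _ , _ , ≈-refl , ≈-refl , left e′

    edges←₂ : ∀ {i a j} → XEdge Ed₂ i a j → ∃₂ λ v v′ → F v i × F v′ j × E v a v′
    edges←₂ e = let (v , v′ , f , g , e′) = S.edges← e in
      inj₂ v , inj₂ v′ , f , g , _ , _ , ≈-refl , ≈-refl , right e′

    edges← : ∀ {i a j} → XEdge UEd i a j → ∃₂ λ v v′ → F v i × F v′ j × E v a v′
    edges← (inj₁ (inj₁ e)) = edges←₁ (inj₁ e)
    edges← (inj₂ (inj₁ e)) = edges←₁ (inj₂ e)
    edges← (inj₁ (inj₂ e)) = edges←₂ (inj₁ e)
    edges← (inj₂ (inj₂ e)) = edges←₂ (inj₂ e)

  -- The parts may share only `w`, where `middle` glues their classes; any other shared vertex would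
  -- need an identification that the term graph does not make.
  Rep-· : ∀ {x w y} → Rep x w Sc₁ Ed₁ u → Rep w y Sc₂ Ed₂ v₀ →
          (∀ {i} → Sc₁ i → Sc₂ i → i ≡ w) →
          Rep x y (λ i → Sc₁ i ⊎ Sc₂ i) UEd (u · v₀)
  Rep-· {x} {w} {y} R S sep = record
    { F = F ; total = total ; scope = λ {v} → scope {v} ; hits = hits ; F-ι = R.F-ι ; F-o = S.F-o
    ; inj = inj λ { p q → case sep (R.scope p) (S.scope q) of λ { refl →
        ≈-trans (inl (R.inj p R.F-o)) (≈-trans (EqClosure.return (inj₂ middle)) (inr (S.inj S.F-ι q))) } }
    ; identify = identify λ { middle → w , R.F-o , S.F-ι }
    ; glue = glue ; edges→ = edges→ ; edges← = edges←
    }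
    where
    module R = Rep R
    module S = Rep S
    open Glued R S (inj₁ R.ι) (inj₂ S.o) (SeriesGlue (termGraph u) (termGraph v₀))
    open Graph GG using (≈-trans)

  Rep-∩ : ∀ {x y} → Rep x y Sc₁ Ed₁ u → Rep x y Sc₂ Ed₂ v₀ →
          (∀ {i} → Sc₁ i → Sc₂ i → i ≡ x ⊎ i ≡ y) →
          Rep x y (λ i → Sc₁ i ⊎ Sc₂ i) UEd (u ∩ v₀)
  Rep-∩ {x} {y} R S sep = record
    { F = F ; total = total ; scope = λ {v} → scope {v} ; hits = hits ; F-ι = R.F-ι ; F-o = R.F-o
    ; inj = inj λ { p q → case sep (R.scope p) (S.scope q) of λ
        { (inj₁ refl) →
            ≈-trans (inl (R.inj p R.F-ι)) (≈-trans (EqClosure.return (inj₂ inputs)) (inr (S.inj S.F-ι q)))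
        ; (inj₂ refl) →
            ≈-trans (inl (R.inj p R.F-o)) (≈-trans (EqClosure.return (inj₂ outputs)) (inr (S.inj S.F-o q)))
        } }
    ; identify = identify λ { inputs → x , R.F-ι , S.F-ι ; outputs → y , R.F-o , S.F-o }
    ; glue = glue ; edges→ = edges→ ; edges← = edges←
    }
    where
    module R = Rep R
    module S = Rep S
    open Glued R S (inj₁ R.ι) (inj₁ R.o) (ParallelGlue (termGraph u) (termGraph v₀))
    open Graph GG using (≈-trans)

-- Choosing a class for each vertex and a vertex in each class gives inverse maps: `glue` makes the
-- first respect the 𝟙-edges, and `identify`, at the equivalence of the quotient, makes the second
-- respect `≈`.
Rep⇒≅ : ∀ {n} {Ed : Fin n → Ext X → Fin n → Set} {x y u} →
        Rep x y (λ _ → Unit) Ed u → overline (finGraph Ed x y) ≅ termGraph u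
Rep⇒≅ {n = n} {Ed} {x} {y} {u} R = record
  { vertex-iso = record
    { to = to ; from = λ v → proj₁ (total v)
    ; to-cong = to-cong
    ; from-cong = λ {v} {v′} p → ∼-cong p (proj₂ (total v)) (proj₂ (total v′))
    ; inverse = (λ {v} p → ≈-trans (to-cong p) (inj (to-F _) (proj₂ (total v))))
              , (λ {i} {v} p → ∼-cong p (proj₂ (total v)) (to-F i))
    }
  ; edges = λ i a j → mk⇔
      (λ (k , l , p , q , e) → let (v , v′ , f , g , e′) = edges← e in
         E-resp (≈-trans (inj f (to-F k)) (≈-sym (to-cong p)))
                (≈-trans (inj g (to-F l)) (≈-sym (to-cong q))) e′)
      (λ e → let (_ , _ , k , l , p , q , f , g , e′) = edges→ e in
         k , l , ∼-cong p (to-F i) f , ∼-cong q (to-F j) g , e′)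
  ; input = inj (to-F x) F-ι
  ; output = inj (to-F y) F-o
  }
  where
  open Rep R
  H : Graph _
  H = overline (finGraph Ed x y)
  _∼_ : Rel (Fin n) 0ℓ
  _∼_ = Graph._≈_ H
  to : Fin n → Vertex
  to i = proj₁ (hits {i} tt)
  to-F : ∀ i → F (to i) i
  to-F i = proj₂ (hits {i} tt)
  ∼-cong : ∀ {v v′ i j} → v ≈ v′ → F v i → F v′ j → i ∼ j
  ∼-cong = identify (EqClosure.isEquivalence _) (λ e → EqClosure.return (inj₂ e))
  step : ∀ {i j} → i ≡ j ⊎ Ed i 𝟙 j → to i ≈ to j
  step (inj₁ refl) = ≈-refl
  step (inj₂ e) = let (_ , _ , f , g , p) = glue e in
    ≈-trans (inj (to-F _) f) (≈-trans p (inj g (to-F _)))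
  to-cong : ∀ {i j} → i ∼ j → to i ≈ to j
  to-cong ε = ≈-refl
  to-cong (fwd s ◅ t) = ≈-trans (step s) (to-cong t)
  to-cong (bwd s ◅ t) = ≈-trans (≈-sym (step s)) (to-cong t)

-- Tokens in safe runs

x∈p─q⇒x∉q : ∀ {n} {x : Fin n} (p q : Subset n) → x Subset.∈ p ─ q → ¬ x Subset.∈ q
x∈p─q⇒x∉q (_ ∷ p) (_ ∷ q) (there r) (there s) = x∈p─q⇒x∉q p q r s
x∈p─q⇒x∉q (_ ∷ p) (_ ∷ q) () here

∈⇒∈π₂ : ∀ {Y n a} {p : Fin n} {es : List (Y × Fin n)} → (a , p) ∈ es → p Subset.∈ π₂ es
∈⇒∈π₂ {p = p} (here refl)   = x∈p∪q⁺ (inj₁ (x∈⁅x⁆ p))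
∈⇒∈π₂ (there e∈es) = x∈p∪q⁺ (inj₂ (∈⇒∈π₂ e∈es))

∈π₂⇒∈ : ∀ {Y n} {p : Fin n} (es : List (Y × Fin n)) → p Subset.∈ π₂ es → ∃ λ a → (a , p) ∈ es
∈π₂⇒∈ []             p∈ = contradiction p∈ ∉⊥
∈π₂⇒∈ ((a , q) ∷ es) p∈ with x∈p∪q⁻ ⁅ q ⁆ (π₂ es) p∈
... | inj₁ p∈q with refl ← x∈⁅y⁆⇒x≡y q p∈q = a , here refl
... | inj₂ p∈es = let (b , e) = ∈π₂⇒∈ es p∈es in b , there e

Disjoint : ∀ {n} → Subset n → Subset n → Set
Disjoint A B = ∀ {p} → p Subset.∈ A → p Subset.∈ B → Empty.⊥

module Tokens {Y : Set} (𝒜 : PetriAutomaton Y) where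
  open PetriAutomaton 𝒜

  out : Transition Y #places → State
  out t = π₂ (post t)

  ∈-fire⁻ : ∀ t S {p} → p Subset.∈ fire t S → (p Subset.∈ S × ¬ p Subset.∈ pre t) ⊎ p Subset.∈ out t
  ∈-fire⁻ t S p∈ = Sum.map₁
    (λ q → p─q⊆p S (pre t) q , x∈p─q⇒x∉q S (pre t) q)
    (x∈p∪q⁻ (S ─ pre t) (out t) p∈)

  ∈-fire⁺ : ∀ t S {p} → p Subset.∈ S → ¬ p Subset.∈ pre t → p Subset.∈ fire t S
  ∈-fire⁺ t S p∈ p∉ = x∈p∪q⁺ (inj₁ (x∈p∧x∉q⇒x∈p─q p∈ p∉))

  Run-++ : ∀ {m n S S′ S″} {ts : Vec _ m} {ts′ : Vec _ n} →
           Run S ts S′ → Run S′ ts′ S″ → Run S (ts ++ ts′) S″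
  Run-++ []      s = s
  Run-++ (x ∷ r) s = x ∷ Run-++ r s

  Reachable-fire : ∀ {S t} → Reachable S → t ∈ transitions → Enabled t S → Reachable (fire t S)
  Reachable-fire (_ , _ , r) t∈ en = _ , _ , Run-++ r ((t∈ , en) ∷ [])

  Run⇒∈ : ∀ {n S S′} {ts : Vec _ n} → Run S ts S′ → ∀ k → lookup ts k ∈ transitions
  Run⇒∈ ((t∈ , _) ∷ r) zero    = t∈
  Run⇒∈ (_        ∷ r) (suc k) = Run⇒∈ r k

  -- `NextConsumer` for a token of the starting state, as if produced just before position `zero`.
  First : ∀ {n} → Vec (Transition Y #places) n → Place → Fin n → Set
  First ts p l = p Subset.∈ pre (lookup ts l) × (∀ l′ → p Subset.∈ pre (lookup ts l′) → l ≤ l′)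

  Token : ∀ {n} → Vec (Transition Y #places) n → Fin n → Place → Fin n → Set
  Token ts k p l = p Subset.∈ out (lookup ts k) × NextConsumer ts k p l

  module _ {n} {t : Transition Y #places} {ts : Vec (Transition Y #places) n} {p : Place} where

    First-suc : ∀ {l} → ¬ p Subset.∈ pre t → First ts p l → First (t ∷ ts) p (suc l)
    First-suc p∉ (c , min) = c , λ { zero c′ → contradiction c′ p∉ ; (suc l′) c′ → s≤s (min l′ c′) }

    First-pred : ∀ {l} → First (t ∷ ts) p (suc l) → First ts p l
    First-pred (c , min) = c , λ l′ c′ → ℕ.s≤s⁻¹ (min (suc l′) c′)

    Next-zero : ∀ {l} → First ts p l → NextConsumer (t ∷ ts) zero p (suc l)
    Next-zero (c , min) = (z<s , c) , λ { zero (() , _) ; (suc l′) (_ , c′) → s≤s (min l′ c′) }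

    Next-zero⁻ : ∀ {l} → NextConsumer (t ∷ ts) zero p (suc l) → First ts p l
    Next-zero⁻ ((_ , c) , min) = c , λ l′ c′ → ℕ.s≤s⁻¹ (min (suc l′) (z<s , c′))

    Next-suc : ∀ {k l} → NextConsumer ts k p l → NextConsumer (t ∷ ts) (suc k) p (suc l)
    Next-suc ((k<l , c) , min) = (s<s k<l , c) ,
      λ { zero (() , _) ; (suc l′) (k<l′ , c′) → s≤s (min l′ (ℕ.s<s⁻¹ k<l′ , c′)) }

    Next-suc⁻ : ∀ {k l} → NextConsumer (t ∷ ts) (suc k) p (suc l) → NextConsumer ts k p l
    Next-suc⁻ ((k<l , c) , min) = (ℕ.s<s⁻¹ k<l , c) ,
      λ l′ (k<l′ , c′) → ℕ.s≤s⁻¹ (min (suc l′) (s<s k<l′ , c′))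

  consumer-unique : ∀ {n} {ts : Vec _ n} {k p l l′} →
                    NextConsumer ts k p l → NextConsumer ts k p l′ → l ≡ l′
  consumer-unique (c , min) (c′ , min′) = Fin.≤-antisym (min _ c′) (min′ _ c)

  first-consumer : ∀ {n S p} {ts : Vec _ n} → Run S ts Subset.⊥ → p Subset.∈ S → ∃ (First ts p)
  first-consumer [] p∈ = contradiction p∈ ∉⊥
  first-consumer {S = S} {p} {ts = t ∷ _} (_ ∷ r) p∈ with p ∈? pre t
  ... | yes c = zero , c , λ _ _ → z≤n
  ... | no p∉ = let (l , f) = first-consumer r (∈-fire⁺ t S p∈ p∉) in suc l , First-suc p∉ f

  consumer-exists : ∀ {n S p} {ts : Vec _ n} → Run S ts Subset.⊥ →
                    ∀ k → p Subset.∈ out (lookup ts k) → ∃ (NextConsumer ts k p)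
  consumer-exists {S = S} {ts = t ∷ _} (_ ∷ r) zero p∈ =
    let (l , f) = first-consumer r (x∈p∪q⁺ (inj₂ p∈)) in suc l , Next-zero f
  consumer-exists (_ ∷ r) (suc k) p∈ = let (l , f) = consumer-exists r k p∈ in suc l , Next-suc f

  token-source : ∀ {n S S′ p} {ts : Vec _ n} → Run S ts S′ → ∀ l → p Subset.∈ pre (lookup ts l) →
                 (p Subset.∈ S × First ts p l) ⊎ (∃ λ k → Token ts k p l)
  token-source ((_ , en) ∷ r) zero c = inj₁ (en c , c , λ _ _ → z≤n)
  token-source {S = S} {ts = t ∷ _} (_ ∷ r) (suc l) c with token-source r l c
  ... | inj₂ (k , p∈ , next) = inj₂ (suc k , p∈ , Next-suc next)
  ... | inj₁ (p∈ , first) with ∈-fire⁻ t S p∈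
  ...   | inj₁ (p∈S , p∉) = inj₁ (p∈S , First-suc p∉ first)
  ...   | inj₂ p∈out      = inj₂ (zero , p∈out , Next-zero first)

  -- Until its first consumer fires, `p` stays in the state, and safety forbids producing a token on
  -- an occupied place.
  first-unproduced : ∀ {n S S′ p} {ts : Vec _ n} → Reachable S → Run S ts S′ → p Subset.∈ S →
                     ∀ {l} → First ts p l → ∀ {k} → k < l → ¬ p Subset.∈ out (lookup ts k)
  first-unproduced {S = S} {ts = t ∷ _} reach ((t∈ , en) ∷ r) p∈ {suc l} (c , min) {zero} _ p∈out =
    safe reach t∈ en (_ , x∈p∩q⁺ (x∈p∧x∉q⇒x∈p─q p∈ (λ q → ℕ.n≮0 (min zero q)) , p∈out))
  first-unproduced {S = S} {ts = t ∷ _} reach ((t∈ , en) ∷ r) p∈ {suc l} f@(c , min) {suc k} k<l =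
    first-unproduced (Reachable-fire reach t∈ en) r (∈-fire⁺ t S p∈ (λ q → ℕ.n≮0 (min zero q)))
      (First-pred f) (ℕ.s<s⁻¹ k<l)

  -- With two producers, the token of the earlier one would still be waiting for `l` when the later
  -- one fires, against `first-unproduced`.
  producer-unique : ∀ {n S S′ p} {ts : Vec _ n} → Reachable S → Run S ts S′ →
                    ∀ {k k′ l} → Token ts k p l → Token ts k′ p l → k ≡ k′
  producer-unique reach (_ ∷ r) {zero} {zero} _ _ = refl
  producer-unique reach ((t∈ , en) ∷ r) {zero} {suc k′} {suc l} (p∈ , next) (p∈′ , ((k<l , _) , _)) =
    contradiction p∈′
      (first-unproduced (Reachable-fire reach t∈ en) r (x∈p∪q⁺ (inj₂ p∈)) (Next-zero⁻ next) (ℕ.s<s⁻¹ k<l))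
  producer-unique reach ((t∈ , en) ∷ r) {suc k} {zero} {suc l} (p∈ , ((k<l , _) , _)) (p∈′ , next) =
    contradiction p∈
      (first-unproduced (Reachable-fire reach t∈ en) r (x∈p∪q⁺ (inj₂ p∈′)) (Next-zero⁻ next) (ℕ.s<s⁻¹ k<l))
  producer-unique reach ((t∈ , en) ∷ r) {suc k} {suc k′} {suc l} (p∈ , n) (p∈′ , n′) =
    cong suc (producer-unique (Reachable-fire reach t∈ en) r (p∈ , Next-suc⁻ n) (p∈′ , Next-suc⁻ n′))
  producer-unique reach r {zero} {_} {zero} (_ , ((() , _) , _)) _
  producer-unique reach r {suc _} {_} {zero} (_ , ((() , _) , _)) _

  start-reachable : Reachable ⁅ ι ⁆
  start-reachable = _ , _ , []

  pre-first : ∀ {n S} {ts : Vec _ (ℕ.suc n)} → Run ⁅ ι ⁆ ts S → ι Subset.∈ pre (lookup ts zero)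
  pre-first {ts = t ∷ _} ((_ , en) ∷ _) with nonempty t
  ... | p , p∈ with refl ← x∈⁅y⁆⇒x≡y ι (en p∈) = p∈

  producer-exists : ∀ {n S p} {ts : Vec _ (ℕ.suc n)} → Run ⁅ ι ⁆ ts S →
                    ∀ l → l ≢ zero → p Subset.∈ pre (lookup ts l) → ∃ λ k → Token ts k p l
  producer-exists r l l≢0 c with token-source r l c
  ... | inj₂ tok = tok
  -- The only initial token is `ι`, and transition `zero` is already a consumer of it, so `l` cannot
  -- be the first.
  ... | inj₁ (p∈ι , _ , min) with refl ← x∈⁅y⁆⇒x≡y ι p∈ι =
    contradiction (Fin.≤-antisym (min zero (pre-first r)) z≤n) l≢0

-- Series-parallel blocks of a run

-- The final ⊤ is neutral: both are placed between the same two vertices.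

edgesTerm : ∀ {n} → List (Ext X × Fin n) → Subset n → Term X
edgesTerm []             A = ⊤
edgesTerm ((a , p) ∷ es) A = if does (p ∈? A) then letterTerm a ∩ edgesTerm es A else edgesTerm es A

Rep-edges : ∀ {V : Set} {x y : V} → x ≢ y → ∀ {n} (es : List (Ext X × Fin n)) (A : Subset n) →
            Rep x y (λ i → i ≡ x ⊎ i ≡ y)
              (λ i a j → i ≡ x × j ≡ y × ∃ λ p → (a , p) ∈ es × p Subset.∈ A)
              (edgesTerm es A)
Rep-edges x≢y [] A = Rep-map (mk⇔ id id) (mk⇔ (λ ()) (λ { (_ , _ , _ , () , _) })) (Rep-⊤ x≢y)
Rep-edges x≢y ((a , p) ∷ es) A with p ∈? A
... | yes p∈ = Rep-map (mk⇔ (λ { (inj₁ e) → e ; (inj₂ e) → e }) inj₁)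
  (mk⇔ (λ { (inj₁ (refl , refl , refl)) → refl , refl , p , here refl , p∈
          ; (inj₂ (i≡x , j≡y , q , e , q∈)) → i≡x , j≡y , q , there e , q∈ })
       (λ { (refl , refl , q , here refl , q∈) → inj₁ (refl , refl , refl)
          ; (i≡x , j≡y , q , there e , q∈) → inj₂ (i≡x , j≡y , q , e , q∈) }))
  (Rep-∩ (Rep-letter x≢y a) (Rep-edges x≢y es A) (λ e _ → e))
... | no p∉ = Rep-map (mk⇔ id id)
  (mk⇔ (λ (i≡x , j≡y , q , e , q∈) → i≡x , j≡y , q , there e , q∈)
       (λ { (refl , refl , q , here refl , q∈) → contradiction q∈ p∉
          ; (i≡x , j≡y , q , there e , q∈) → i≡x , j≡y , q , e , q∈ }))
  (Rep-edges x≢y es A)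

module Blocks {X : Set} (𝒜 : PetriAutomaton (Ext X)) where
  open PetriAutomaton 𝒜
  open Tokens 𝒜

  -- A series-parallel part of a run ts, with the term of its graph: between
  -- the transitions x and y it carries the tokens A that x produces and the
  -- tokens B that y consumes.

  data Block {N} (ts : Vec (Transition (Ext X) #places) N) :
             Fin N → Fin N → State → State → Term X → Set where
    atom : ∀ {x y A} → Nonempty A → (∀ {p} → p Subset.∈ A → Token ts x p y) →
           Block ts x y A A (edgesTerm (post (lookup ts x)) A)
    -- All of `pre` and all of `out` at `w`: nothing enters or leaves a block at an inner vertex.
    ser  : ∀ {x y A B u v} w → Block ts x w A (pre (lookup ts w)) u →
           Block ts w y (out (lookup ts w)) B v → Block ts x y A B (u · v)
    par  : ∀ {x y A₁ A₂ B₁ B₂ u v} → Disjoint A₁ A₂ →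
           Block ts x y A₁ B₁ u → Block ts x y A₂ B₂ v →
           Block ts x y (A₁ Subset.∪ A₂) (B₁ Subset.∪ B₂) (u ∩ v)

  module _ {N} {ts : Vec (Transition (Ext X) #places) N} where

    Block-nonempty : ∀ {x y A B u} → Block ts x y A B u → Nonempty A
    Block-nonempty (atom ne _)     = ne
    Block-nonempty (ser _ D _)     = Block-nonempty D
    Block-nonempty (par {A₁ = A₁} {A₂} _ D _) = let (p , p∈) = Block-nonempty D in p , p⊆p∪q A₂ p∈

    Block-< : ∀ {x y A B u} → Block ts x y A B u → x < y
    Block-< (atom (p , p∈) tok) = proj₁ (proj₁ (proj₂ (tok p∈)))
    Block-< (ser _ D D′)        = Fin.<-trans (Block-< D) (Block-< D′)
    Block-< (par _ D _)         = Block-< D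

    Scope : ∀ {x y A B u} → Block ts x y A B u → Fin N → Set
    Scope (atom {x} {y} _ _) i = i ≡ x ⊎ i ≡ y
    Scope (ser _ D D′)       i = Scope D i ⊎ Scope D′ i
    Scope (par _ D D′)       i = Scope D i ⊎ Scope D′ i

    Uses : ∀ {x y A B u} → Block ts x y A B u → Fin N → Place → Fin N → Set
    Uses (atom {x} {y} {A} _ _) k p l = k ≡ x × l ≡ y × p Subset.∈ A
    Uses (ser _ D D′)           k p l = Uses D k p l ⊎ Uses D′ k p l
    Uses (par _ D D′)           k p l = Uses D k p l ⊎ Uses D′ k p l

    Edges : ∀ {x y A B u} → Block ts x y A B u → Fin N → Ext X → Fin N → Set
    Edges D k a l = ∃ λ p → (a , p) ∈ post (lookup ts k) × Uses D k p l

    Scope-≤ : ∀ {x y A B u i} (D : Block ts x y A B u) → Scope D i → x ≤ i × i ≤ y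
    Scope-≤ D@(atom _ _) (inj₁ refl) = Fin.≤-refl , ℕ.<⇒≤ (Block-< D)
    Scope-≤ D@(atom _ _) (inj₂ refl) = ℕ.<⇒≤ (Block-< D) , Fin.≤-refl
    Scope-≤ (ser _ D D′) (inj₁ s)    =
      let (p , q) = Scope-≤ D s in p , Fin.≤-trans q (ℕ.<⇒≤ (Block-< D′))
    Scope-≤ (ser _ D D′) (inj₂ s)    =
      let (p , q) = Scope-≤ D′ s in Fin.≤-trans (ℕ.<⇒≤ (Block-< D)) p , q
    Scope-≤ (par _ D D′) (inj₁ s)    = Scope-≤ D s
    Scope-≤ (par _ D D′) (inj₂ s)    = Scope-≤ D′ s

    Scope-x : ∀ {x y A B u} (D : Block ts x y A B u) → Scope D x
    Scope-x (atom _ _)   = inj₁ refl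
    Scope-x (ser _ D D′) = inj₁ (Scope-x D)
    Scope-x (par _ D D′) = inj₁ (Scope-x D)

    Uses-token : ∀ {x y A B u k p l} (D : Block ts x y A B u) → Uses D k p l → Token ts k p l
    Uses-token (atom _ tok) (refl , refl , p∈) = tok p∈
    Uses-token (ser _ D D′) = Sum.[ Uses-token D , Uses-token D′ ]
    Uses-token (par _ D D′) = Sum.[ Uses-token D , Uses-token D′ ]

    Uses-scope : ∀ {x y A B u k p l} (D : Block ts x y A B u) → Uses D k p l → Scope D l
    Uses-scope (atom _ tok) (refl , refl , p∈) = inj₂ refl
    Uses-scope (ser _ D D′) = Sum.map (Uses-scope D) (Uses-scope D′)
    Uses-scope (par _ D D′) = Sum.map (Uses-scope D) (Uses-scope D′)

  module _ {n} {ts : Vec (Transition (Ext X) #places) (ℕ.suc n)} (accepting : Accepting ts) where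

    private
      τ : Fin (ℕ.suc n) → Transition (Ext X) #places
      τ = lookup ts

    Input : ∀ {x y A B u} → Block ts x y A B u → Fin (ℕ.suc n) → Place → Set
    Input {x} {y} {B = B} D l p =
      (l ≡ y × p Subset.∈ B) ⊎ (Scope D l × l ≢ x × l ≢ y × p Subset.∈ pre (τ l))

    -- Following a token back to its producer stays inside the block, and can arrive at `x` only
    -- with a token of `A`. At an atom this is uniqueness of the producer; at a series joint all of
    -- `pre` belongs to the first part.
    consumed-from : ∀ {x y A B u k p l} (D : Block ts x y A B u) → Token ts k p l →
      Input D l p →
      (k ≡ x × p Subset.∈ A) ⊎ (Scope D k × k ≢ x)
    consumed-from (atom _ toks) tok (inj₁ (refl , p∈)) =
      inj₁ (producer-unique start-reachable accepting tok (toks p∈) , p∈)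
    consumed-from (atom _ _) tok (inj₂ (inj₁ l≡x , l≢x , _)) = contradiction l≡x l≢x
    consumed-from (atom _ _) tok (inj₂ (inj₂ l≡y , _ , l≢y , _)) = contradiction l≡y l≢y
    consumed-from {x} {y} {A} {B} {k = k} {p} {l} D@(ser w D₁ D₂) tok c = case c of λ
      { (inj₁ (l≡y , p∈)) → via₂ (inj₁ (l≡y , p∈))
      ; (inj₂ (inj₁ s , l≢x , l≢y , p∈)) → case l Fin.≟ w of λ
          { (yes refl) → via₁ (inj₁ (refl , p∈))
          ; (no l≢w)   → via₁ (inj₂ (s , l≢x , l≢w , p∈)) }
      ; (inj₂ (inj₂ s , l≢x , l≢y , p∈)) → case l Fin.≟ w of λ
          { (yes refl) → via₁ (inj₁ (refl , p∈))
          ; (no l≢w)   → via₂ (inj₂ (s , l≢w , l≢y , p∈)) }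
      }
      where
      via₁ : Input D₁ l p → (k ≡ x × p Subset.∈ A) ⊎ (Scope D k × k ≢ x)
      via₁ c = Sum.map₂ (λ (s , k≢x) → inj₁ s , k≢x) (consumed-from D₁ tok c)
      via₂ : Input D₂ l p → (k ≡ x × p Subset.∈ A) ⊎ (Scope D k × k ≢ x)
      via₂ c = inj₂ (case consumed-from D₂ tok c of λ
        { (inj₁ (refl , _)) → inj₂ (Scope-x D₂) , Fin.<⇒≢ (Block-< D₁) ∘ sym
        ; (inj₂ (s , _))    → inj₂ s , Fin.<⇒≢ (ℕ.<-≤-trans (Block-< D₁) (proj₁ (Scope-≤ D₂ s))) ∘ sym })
    consumed-from {x} {y} {A} {B} {k = k} {p} {l} D@(par {A₁ = A₁} {A₂} {B₁} {B₂} _ D₁ D₂) tok c = case c of λ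
      { (inj₁ (l≡y , p∈)) → case x∈p∪q⁻ B₁ B₂ p∈ of λ
          { (inj₁ p∈₁) → via₁ (inj₁ (l≡y , p∈₁))
          ; (inj₂ p∈₂) → via₂ (inj₁ (l≡y , p∈₂)) }
      ; (inj₂ (inj₁ s , h)) → via₁ (inj₂ (s , h))
      ; (inj₂ (inj₂ s , h)) → via₂ (inj₂ (s , h))
      }
      where
      via₁ : Input D₁ l p → (k ≡ x × p Subset.∈ A) ⊎ (Scope D k × k ≢ x)
      via₁ c = Sum.map (λ (e , p∈) → e , p⊆p∪q A₂ p∈) (λ (s , k≢x) → inj₁ s , k≢x) (consumed-from D₁ tok c)
      via₂ : Input D₂ l p → (k ≡ x × p Subset.∈ A) ⊎ (Scope D k × k ≢ x)
      via₂ c = Sum.map (λ (e , p∈) → e , q⊆p∪q A₁ A₂ p∈) (λ (s , k≢x) → inj₂ s , k≢x) (consumed-from D₂ tok c)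

    -- The forward counterpart of `consumed-from`, by uniqueness of the consumer: tokens leaving an
    -- inner vertex stay in the block, so it misses no edge of the trace there.
    produced-used : ∀ {x y A B u k p l} (D : Block ts x y A B u) → Token ts k p l →
      (k ≡ x × p Subset.∈ A) ⊎ (Scope D k × k ≢ x × k ≢ y) → Uses D k p l
    produced-used (atom _ toks) tok (inj₁ (refl , p∈)) =
      refl , consumer-unique {ts = ts} (proj₂ tok) (proj₂ (toks p∈)) , p∈
    produced-used (atom _ _) tok (inj₂ (inj₁ k≡x , k≢x , _)) = contradiction k≡x k≢x
    produced-used (atom _ _) tok (inj₂ (inj₂ k≡y , _ , k≢y)) = contradiction k≡y k≢y
    produced-used (ser w D₁ D₂) tok (inj₁ h) = inj₁ (produced-used D₁ tok (inj₁ h))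
    produced-used {k = k} (ser w D₁ D₂) tok (inj₂ (s , k≢x , k≢y)) with k Fin.≟ w
    ... | yes refl = inj₂ (produced-used D₂ tok (inj₁ (refl , proj₁ tok)))
    ... | no k≢w with s
    ...   | inj₁ s₁ = inj₁ (produced-used D₁ tok (inj₂ (s₁ , k≢x , k≢w)))
    ...   | inj₂ s₂ = inj₂ (produced-used D₂ tok (inj₂ (s₂ , k≢w , k≢y)))
    produced-used (par {A₁ = A₁} {A₂} _ D₁ D₂) tok (inj₁ (k≡x , p∈)) with x∈p∪q⁻ A₁ A₂ p∈
    ... | inj₁ p∈₁ = inj₁ (produced-used D₁ tok (inj₁ (k≡x , p∈₁)))
    ... | inj₂ p∈₂ = inj₂ (produced-used D₂ tok (inj₁ (k≡x , p∈₂)))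
    produced-used (par _ D₁ D₂) tok (inj₂ (inj₁ s , h)) = inj₁ (produced-used D₁ tok (inj₂ (s , h)))
    produced-used (par _ D₁ D₂) tok (inj₂ (inj₂ s , h)) = inj₂ (produced-used D₂ tok (inj₂ (s , h)))

    -- The producers of the tokens that a common inner vertex consumes are
    -- again common, so that descending leads to a token in A₁ and A₂.

    par-scopes : ∀ {x y A₁ A₂ B₁ B₂ u v} → Disjoint A₁ A₂ →
                 (D₁ : Block ts x y A₁ B₁ u) (D₂ : Block ts x y A₂ B₂ v) →
                 ∀ {i} → Scope D₁ i → Scope D₂ i → i ≡ x ⊎ i ≡ y
    par-scopes {x} {y} disj D₁ D₂ {i} = go (<-wellFounded i)
      where
      go : ∀ {i} → Acc _<_ i → Scope D₁ i → Scope D₂ i → i ≡ x ⊎ i ≡ y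
      go {i} (acc rec) s₁ s₂ with i Fin.≟ x | i Fin.≟ y
      ... | yes i≡x | _       = inj₁ i≡x
      ... | no _    | yes i≡y = inj₂ i≡y
      ... | no i≢x  | no i≢y  with nonempty (τ i)
      ...   | p , p∈ with producer-exists accepting i
                            (λ { refl → i≢x (Fin.≤-antisym z≤n (proj₁ (Scope-≤ D₁ s₁))) }) p∈
      ...     | k , tok with consumed-from D₁ tok (inj₂ (s₁ , i≢x , i≢y , p∈))
                           | consumed-from D₂ tok (inj₂ (s₂ , i≢x , i≢y , p∈))
      ...       | inj₁ (_ , p∈₁)   | inj₁ (_ , p∈₂)   = ⊥-elim (disj p∈₁ p∈₂)
      ...       | inj₁ (k≡x , _)   | inj₂ (_ , k≢x)   = contradiction k≡x k≢x
      ...       | inj₂ (_ , k≢x)   | inj₁ (k≡x , _)   = contradiction k≡x k≢x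
      ...       | inj₂ (s₁′ , k≢x) | inj₂ (s₂′ , _)   with go (rec k<i) s₁′ s₂′
        where
        k<i : k < i
        k<i = proj₁ (proj₁ (proj₂ tok))
      ...         | inj₁ k≡x  = contradiction k≡x k≢x
      ...         | inj₂ refl = contradiction (proj₁ (proj₁ (proj₂ tok))) (ℕ.≤⇒≯ (proj₂ (Scope-≤ D₁ s₁)))

    Edges-⊎ : ∀ {x y A B u x′ y′ A′ B′ u′} (D : Block ts x y A B u) (D′ : Block ts x′ y′ A′ B′ u′) →
              ∀ {k a l} → (Edges D k a l ⊎ Edges D′ k a l) ⇔
                          (∃ λ p → (a , p) ∈ post (τ k) × (Uses D k p l ⊎ Uses D′ k p l))
    Edges-⊎ D D′ = mk⇔
      (λ { (inj₁ (p , e , h)) → p , e , inj₁ h ; (inj₂ (p , e , h)) → p , e , inj₂ h })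
      (λ { (p , e , inj₁ h) → inj₁ (p , e , h) ; (p , e , inj₂ h) → inj₂ (p , e , h) })

    Block-Rep : ∀ {x y A B u} (D : Block ts x y A B u) → Rep x y (Scope D) (Edges D) u
    Block-Rep {x} {y} {A} D@(atom _ _) = Rep-map (mk⇔ id id)
      (mk⇔ (λ { (refl , refl , p , e , p∈) → p , e , refl , refl , p∈ })
           (λ { (p , e , refl , refl , p∈) → refl , refl , p , e , p∈ }))
      (Rep-edges (Fin.<⇒≢ (Block-< D)) (post (τ x)) A)
    Block-Rep (ser w D₁ D₂) = Rep-map (mk⇔ id id) (Edges-⊎ D₁ D₂)
      (Rep-· (Block-Rep D₁) (Block-Rep D₂)
        (λ s₁ s₂ → Fin.≤-antisym (proj₂ (Scope-≤ D₁ s₁)) (proj₁ (Scope-≤ D₂ s₂))))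
    Block-Rep (par disj D₁ D₂) = Rep-map (mk⇔ id id) (Edges-⊎ D₁ D₂)
      (Rep-∩ (Block-Rep D₁) (Block-Rep D₂) (par-scopes disj D₁ D₂))

    module _ {u} (D : Block ts zero (fromℕ n) (out (τ zero)) (pre (τ (fromℕ n))) u) where

      uses-all : ∀ {k p l} → Scope D k → Token ts k p l → Uses D k p l
      uses-all {k} s tok with k Fin.≟ zero | k Fin.≟ fromℕ n
      ... | yes refl | _        = produced-used D tok (inj₁ (refl , proj₁ tok))
      ... | no k≢0   | no k≢n   = produced-used D tok (inj₂ (s , k≢0 , k≢n))
      ... | no _     | yes refl = contradiction (proj₁ (proj₁ (proj₂ tok))) (ℕ.≤⇒≯ (Fin.≤fromℕ _))

      -- Every transition but the first takes a token from an earlier one. That one is in the block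
      -- by induction, and the block uses all its tokens, hence contains their consumers.
      scope-all : ∀ i → Scope D i
      scope-all i = go (<-wellFounded i)
        where
        go : ∀ {i} → Acc _<_ i → Scope D i
        go {i} (acc rec) with i Fin.≟ zero
        ... | yes refl = Scope-x D
        ... | no i≢0 with nonempty (τ i)
        ...   | p , p∈ with producer-exists accepting i i≢0 p∈
        ...     | k , tok = Uses-scope D (uses-all (go (rec (proj₁ (proj₁ (proj₂ tok))))) tok)

      Block⇒≅ : overline (trace ts) ≅ termGraph u
      Block⇒≅ = Rep⇒≅ (Rep-map
        (mk⇔ (λ _ → tt) (λ _ → scope-all _))
        (mk⇔ (λ (p , e , h) → p , e , proj₂ (Uses-token D h))
             (λ (p , e , next) → p , e , uses-all (scope-all _) (∈⇒∈π₂ e , next)))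
        (Block-Rep D))

-- From SP-rewriting to blocks

module _ {n} {P : Pred (Fin n) 0ℓ} (P? : Decidable P) where

  satisfying : Subset n
  satisfying = tabulate (does ∘ P?)

  ∈-satisfying⁺ : ∀ {p} → P p → p Subset.∈ satisfying
  ∈-satisfying⁺ {p} h = lookup⇒[]= p satisfying
    (trans (lookup∘tabulate (does ∘ P?) p) (dec-true (P? p) h))

  ∈-satisfying⁻ : ∀ {p} → p Subset.∈ satisfying → P p
  ∈-satisfying⁻ {p} p∈ with P? p | trans (sym (lookup∘tabulate (does ∘ P?) p)) ([]=⇒lookup p∈)
  ... | yes h | _ = h
  ... | no _  | ()

module _ {m n} (M : Fin m → Fin m → Subset n) where

  moveˡ : ∀ {i i′ j p} → i ≡ i′ → p Subset.∈ M i j → p Subset.∈ M i′ j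
  moveˡ refl p∈ = p∈

  moveʳ : ∀ {i j j′ p} → j ≡ j′ → p Subset.∈ M i j → p Subset.∈ M i j′
  moveʳ refl p∈ = p∈

module Update {m n} (M : Fin m → Fin m → Subset n) (x y : Fin m) (S : Subset n) where

  update : Fin m → Fin m → Subset n
  update i j = if does (i Fin.≟ x) ∧ does (j Fin.≟ y) then M i j Subset.∪ S else M i j

  ∈-update⁺ : ∀ {i j p} → p Subset.∈ M i j ⊎ (i ≡ x × j ≡ y × p Subset.∈ S) → p Subset.∈ update i j
  ∈-update⁺ {i} {j} h with i Fin.≟ x | j Fin.≟ y | h
  ... | yes _ | yes _ | inj₁ p∈            = p⊆p∪q S p∈
  ... | yes _ | yes _ | inj₂ (_ , _ , p∈)  = q⊆p∪q (M i j) S p∈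
  ... | yes _ | no _  | inj₁ p∈            = p∈
  ... | yes _ | no j≢y | inj₂ (_ , j≡y , _) = contradiction j≡y j≢y
  ... | no _  | _     | inj₁ p∈            = p∈
  ... | no i≢x | _    | inj₂ (i≡x , _ , _) = contradiction i≡x i≢x

  ∈-update⁻ : ∀ {i j p} → p Subset.∈ update i j → p Subset.∈ M i j ⊎ (i ≡ x × j ≡ y × p Subset.∈ S)
  ∈-update⁻ {i} {j} p∈ with i Fin.≟ x | j Fin.≟ y
  ... | yes i≡x | yes j≡y = Sum.map₂ (λ q → i≡x , j≡y , q) (x∈p∪q⁻ (M i j) S p∈)
  ... | yes _   | no _    = inj₁ p∈
  ... | no _    | _       = inj₁ p∈

open Update using (update; ∈-update⁺; ∈-update⁻)

-- A property relating the entries of two matrices needs both updates resolved by the same pair of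
-- decisions.
update-elim : ∀ {m n} (A B : Fin m → Fin m → Subset n) {x y S S′} {ℓ} (Q : Subset n → Subset n → Set ℓ) →
  ∀ {i j} → Q (A i j) (B i j) → (i ≡ x → j ≡ y → Q (A i j Subset.∪ S) (B i j Subset.∪ S′)) →
  Q (update A x y S i j) (update B x y S′ i j)
update-elim A B {x} {y} Q {i} {j} old new with i Fin.≟ x | j Fin.≟ y
... | yes i≡x | yes j≡y = new i≡x j≡y
... | yes _   | no _    = old
... | no _    | _       = old

module Elimination {X : Set} (𝒜 : PetriAutomaton (Ext X)) where
  open PetriAutomaton 𝒜 hiding (ι)
  open Tokens 𝒜
  open Blocks 𝒜

  module _ {n} {ts : Vec (Transition (Ext X) #places) (ℕ.suc n)} (accepting : Accepting ts) where

    private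
      τ : Fin (ℕ.suc n) → Transition (Ext X) #places
      τ = lookup ts

    token? : ∀ k l → Decidable (λ p → Token ts k p l)
    token? k l p = (p ∈? out (τ k)) ×-dec (consumes? l ×-dec
      Fin.all? (λ l′ → consumes? l′ →-dec (l Fin.≤? l′)))
      where
      consumes? : ∀ l → Dec (k < l × p Subset.∈ pre (τ l))
      consumes? l = (k Fin.<? l) ×-dec (p ∈? pre (τ l))

    -- The vertices of G are transitions, each edge of G abbreviates a block,
    -- and every token that reaches or leaves a vertex of G is in such a block.
    -- Labels are ignored, hence parallel steps preserve this.

    record Covered (G : Graph (SPTerm (Ext X))) : Set where
      open Graph G
      field
        at       : Vertex → Fin (ℕ.suc n)
        at-cong  : ∀ {i j} → i ≈ j → at i ≡ at j
        at-inj   : ∀ {i j} → at i ≡ at j → i ≈ j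
        at-ι     : at ι ≡ zero
        at-o     : at o ≡ fromℕ n
        -- Indexed by transitions instead of vertices: the matrices then respect `≈` through
        -- `at-cong`, and `update` can decide equality of indices.
        A B      : Fin (ℕ.suc n) → Fin (ℕ.suc n) → State
        adjacent : ∀ {i j} → (∃ λ a → E i a j) ⇔ Nonempty (A (at i) (at j))
        block    : ∀ {i j} → Nonempty (A (at i) (at j)) →
                   ∃ (Block ts (at i) (at j) (A (at i) (at j)) (B (at i) (at j)))
        B⇒A      : ∀ {i j} → Nonempty (B (at i) (at j)) → Nonempty (A (at i) (at j))
        A⊆out    : ∀ {i j} → A (at i) (at j) Subset.⊆ out (τ (at i))
        B⊆pre    : ∀ {i j} → B (at i) (at j) Subset.⊆ pre (τ (at j))
        produced : ∀ {i p} → p Subset.∈ out (τ (at i)) → ∃ λ j → p Subset.∈ A (at i) (at j)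
        -- Transition `zero` is exempt, since it takes the initial token, which has no producer.
        consumed : ∀ {j p} → p Subset.∈ pre (τ (at j)) → at j ≢ zero → ∃ λ i → p Subset.∈ B (at i) (at j)
        -- Supplies the disjointness that `par` asks for when a series step creates a second
        -- connection from `x` to `y`.
        disjoint : ∀ {i j j′} → at j ≢ at j′ → Disjoint (A (at i) (at j)) (A (at i) (at j′))

    trace-covered : Covered (mapLabels var (trace ts))
    trace-covered = record
      { at = id ; at-cong = id ; at-inj = id ; at-ι = refl ; at-o = refl
      ; A = tokens ; B = tokens
      ; adjacent = λ {i} {j} → mk⇔
          (λ (_ , _ , _ , p , e , next) → p , ∈-satisfying⁺ (token? i j) (∈⇒∈π₂ e , next))
          (λ (p , p∈) → let (p∈out , next) = ∈-satisfying⁻ (token? i j) p∈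
                            (a , e) = ∈π₂⇒∈ (post (τ i)) p∈out
                        in var a , a , refl , p , e , next)
      ; block = λ {i} {j} ne → _ , atom ne (∈-satisfying⁻ (token? i j))
      ; B⇒A = id
      ; A⊆out = λ {i} {j} p∈ → proj₁ (∈-satisfying⁻ (token? i j) p∈)
      ; B⊆pre = λ {i} {j} p∈ → proj₂ (proj₁ (proj₂ (∈-satisfying⁻ (token? i j) p∈)))
      ; produced = λ {i} p∈ → let (j , next) = consumer-exists accepting i p∈ in
          j , ∈-satisfying⁺ (token? i j) (p∈ , next)
      ; consumed = λ {j} p∈ j≢0 → let (i , tok) = producer-exists accepting j j≢0 p∈ in
          i , ∈-satisfying⁺ (token? i j) tok
      ; disjoint = λ {i} {j} {j′} j≢j′ p∈ p∈′ → j≢j′ (consumer-unique {ts = ts}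
          (proj₂ (∈-satisfying⁻ (token? i j) p∈)) (proj₂ (∈-satisfying⁻ (token? i j′) p∈′)))
      }
      where
      tokens : Fin (ℕ.suc n) → Fin (ℕ.suc n) → State
      tokens i j = satisfying (token? i j)

    module _ {G H : Graph (SPTerm (Ext X))} (C : Covered G) where
      private
        module G = Graph G
        module H = Graph H
      open Covered C

      -- All edges between two vertices share one entry of `A` and `B`, so merging two of them
      -- leaves the matrices as they are.
      parallel-covered : ParallelStep G H → Covered H
      parallel-covered step = record
        { at = at ∘ I.from ; at-cong = at-cong ∘ I.from-cong
        ; at-inj = λ e → H.≈-trans (H.≈-sym (I.strictlyInverseˡ _))
                           (H.≈-trans (I.to-cong (at-inj e)) (I.strictlyInverseˡ _))
        ; at-ι = trans (at-cong (I.inverseʳ (H.≈-sym input))) at-ι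
        ; at-o = trans (at-cong (I.inverseʳ (H.≈-sym output))) at-o
        ; A = A ; B = B
        ; adjacent = mk⇔
            (λ (_ , e) → Equivalence.to adjacent (adjacent⁻
              (H.E-resp (H.≈-sym (I.strictlyInverseˡ _)) (H.≈-sym (I.strictlyInverseˡ _)) e)))
            (λ ne → map₂ (H.E-resp (I.strictlyInverseˡ _) (I.strictlyInverseˡ _))
              (adjacent⁺ (proj₂ (Equivalence.from adjacent ne))))
        ; block = block ; B⇒A = B⇒A ; A⊆out = A⊆out ; B⊆pre = B⊆pre
        ; produced = λ p∈ → let (j , q) = produced p∈ in
            I.to j , moveʳ A (at-cong (G.≈-sym (I.strictlyInverseʳ j))) q
        ; consumed = λ p∈ j≢0 → let (i , q) = consumed p∈ j≢0 in
            I.to i , moveˡ B (at-cong (G.≈-sym (I.strictlyInverseʳ i))) q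
        ; disjoint = disjoint
        }
        where
        open ParallelStep step
        module I = Inverse vertex-iso
        adjacent⁻ : ∀ {i a j} → H.E (I.to i) a (I.to j) → ∃ λ b → G.E i b j
        adjacent⁻ e = case Equivalence.to (edges _ _ _) e of λ
          { (inj₁ (e′ , _))        → _ , e′
          ; (inj₂ (i≈x , _ , j≈y)) → u , G.E-resp (G.≈-sym i≈x) (G.≈-sym j≈y) x-u-y }
        adjacent⁺ : ∀ {i a j} → G.E i a j → ∃ λ b → H.E (I.to i) b (I.to j)
        adjacent⁺ {i} {a} {j} e with at i Fin.≟ at x | at j Fin.≟ at y
        ... | yes p | yes q = u ∩ v , Equivalence.from (edges _ _ _) (inj₂ (at-inj p , refl , at-inj q))
        ... | yes _ | no q  = a , Equivalence.from (edges _ _ _)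
                (inj₁ (e , (λ (_ , _ , r) → q (at-cong r)) , (λ (_ , _ , r) → q (at-cong r))))
        ... | no p  | _     = a , Equivalence.from (edges _ _ _)
                (inj₁ (e , (λ (r , _) → p (at-cong r)) , (λ (r , _) → p (at-cong r))))

      -- Since `w` has one neighbour on each side, `consumed` and `produced` force the block from
      -- `x` to end in all of `pre` and the block to `y` to start from all of `out`. So they compose
      -- at `w`, and `par` merges the result with any block already between `x` and `y`.
      series-covered : SeriesStep G H → Covered H
      series-covered step = record
        { at = at ∘ to ; at-cong = at-cong ∘ I.cong ; at-inj = I.injective ∘ at-inj
        ; at-ι = trans (at-cong input) at-ι
        ; at-o = trans (at-cong output) at-o
        ; A = A′ ; B = B′
        ; adjacent = mk⇔
            (λ (_ , e) → case Equivalence.to (edges _ _ _) e of λ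
              { (inj₁ e′) → map₂ (A⁺ ∘ inj₁) (Equivalence.to adjacent (_ , e′))
              ; (inj₂ (i≈x , _ , j≈y)) →
                  map₂ (λ p∈ → A⁺ (inj₂ (at-cong (I.cong i≈x) , at-cong (I.cong j≈y) , p∈))) x-w })
            (λ (p , p∈) → case A⁻ p∈ of λ
              { (inj₁ q) → let (a , e) = Equivalence.from adjacent (p , q) in
                  a , Equivalence.from (edges _ _ _) (inj₁ e)
              ; (inj₂ (i≡x , j≡y , _)) → u · v , Equivalence.from (edges _ _ _)
                  (inj₂ (I.injective (at-inj i≡x) , refl , I.injective (at-inj j≡y))) })
        ; block = λ {i} {j} → update-elim A B (λ S S′ → Nonempty S → ∃ (Block ts (at (to i)) (at (to j)) S S′))
            block (λ i≡x j≡y _ → subst₂′ (sym i≡x) (sym j≡y) new)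
        ; B⇒A = λ (p , p∈) → case B⁻ p∈ of λ
            { (inj₁ q) → map₂ (A⁺ ∘ inj₁) (B⇒A (p , q))
            ; (inj₂ (i≡x , j≡y , _)) → map₂ (λ q → A⁺ (inj₂ (i≡x , j≡y , q))) x-w }
        ; A⊆out = λ p∈ → case A⁻ p∈ of λ
            { (inj₁ q) → A⊆out q
            ; (inj₂ (i≡x , _ , q)) → subst (λ k → _ Subset.∈ out (τ k)) (sym i≡x) (A⊆out q) }
        ; B⊆pre = λ p∈ → case B⁻ p∈ of λ
            { (inj₁ q) → B⊆pre q
            ; (inj₂ (_ , j≡y , q)) → subst (λ k → _ Subset.∈ pre (τ k)) (sym j≡y) (B⊆pre q) }
        -- A token that went to the deleted `w` can only come from `x`; it is now accounted for on
        -- the way to `y`.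
        ; produced = λ p∈ → let (j , q) = produced p∈ in case at j Fin.≟ at w of λ
            { (yes j≡w) → let q′ = moveʳ A j≡w q
                              i≡x = at-cong (only-x (_ , q′)) in
                y , A⁺ (inj₂ (i≡x , refl , moveˡ A i≡x q′))
            ; (no j≢w) → let (h , h≈j) = Equivalence.from (image j) (j≢w ∘ at-cong) in
                h , A⁺ (inj₁ (moveʳ A (sym (at-cong h≈j)) q)) }
        ; consumed = λ p∈ j≢0 → let (i , q) = consumed p∈ j≢0 in case at i Fin.≟ at w of λ
            { (yes i≡w) → let q′ = moveˡ B i≡w q
                              j≡y = at-cong (only-y (B⇒A (_ , q′))) in
                x , B⁺ (inj₂ (refl , j≡y , moveʳ B j≡y q′))
            ; (no i≢w) → let (h , h≈i) = Equivalence.from (image i) (i≢w ∘ at-cong) in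
                h , B⁺ (inj₁ (moveˡ B (sym (at-cong h≈i)) q)) }
        ; disjoint = λ j≢j′ p∈ p∈′ → case A⁻ p∈ of λ
            { (inj₁ q) → case A⁻ p∈′ of λ
                { (inj₁ q′) → disjoint j≢j′ q q′
                ; (inj₂ (i≡x , _ , q′)) → disjoint (≢w _)
                    q (moveˡ A (sym i≡x) q′) }
            ; (inj₂ (i≡x , j≡y , q)) → case A⁻ p∈′ of λ
                { (inj₁ q′) → disjoint (≢w _)
                    q′ (moveˡ A (sym i≡x) q)
                ; (inj₂ (_ , j′≡y , q′)) → j≢j′ (trans j≡y (sym j′≡y)) } }
        }
        where
        open SeriesStep step
        module I = Injection embed
        A′ B′ : Fin (ℕ.suc n) → Fin (ℕ.suc n) → State
        -- The new edge leaves `x` with the tokens sent to `w` and reaches `y` with the tokens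
        -- received from `w`.
        A′ = update A (at (to x)) (at (to y)) (A (at (to x)) (at w))
        B′ = update B (at (to x)) (at (to y)) (B (at w) (at (to y)))
        A⁺ : ∀ {i j p} → _ → p Subset.∈ A′ i j
        A⁺ = ∈-update⁺ A _ _ _
        A⁻ : ∀ {i j p} → p Subset.∈ A′ i j → _
        A⁻ = ∈-update⁻ A _ _ _
        B⁺ : ∀ {i j p} → _ → p Subset.∈ B′ i j
        B⁺ = ∈-update⁺ B _ _ _
        B⁻ : ∀ {i j p} → p Subset.∈ B′ i j → _
        B⁻ = ∈-update⁻ B _ _ _
        ≢w : ∀ h → at (to h) ≢ at w
        ≢w h e = Equivalence.to (image (to h)) (h , G.≈-refl) (at-inj e)
        x-w : Nonempty (A (at (to x)) (at w))
        x-w = Equivalence.to adjacent (u , Equivalence.from (into-w _ _) (G.≈-refl , refl))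
        w-y : Nonempty (A (at w) (at (to y)))
        w-y = Equivalence.to adjacent (v , Equivalence.from (from-w _ _) (refl , G.≈-refl))
        only-x : ∀ {i} → Nonempty (A (at i) (at w)) → i G.≈ to x
        only-x ne = proj₁ (Equivalence.to (into-w _ _) (proj₂ (Equivalence.from adjacent ne)))
        only-y : ∀ {j} → Nonempty (A (at w) (at j)) → j G.≈ to y
        only-y ne = proj₂ (Equivalence.to (from-w _ _) (proj₂ (Equivalence.from adjacent ne)))
        B≡pre : B (at (to x)) (at w) ≡ pre (τ (at w))
        B≡pre = ⊆-antisym B⊆pre λ p∈ →
          let (i , q) = consumed p∈ (λ e → w≉ι (at-inj (trans e (sym at-ι)))) in
          moveˡ B (at-cong (only-x (B⇒A (_ , q)))) q
        A≡out : A (at w) (at (to y)) ≡ out (τ (at w))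
        A≡out = ⊆-antisym A⊆out λ p∈ →
          let (j , q) = produced p∈ in
          moveʳ A (at-cong (only-y (_ , q))) q
        through : ∃ (Block ts (at (to x)) (at (to y)) (A (at (to x)) (at w)) (B (at w) (at (to y))))
        through =
          let (t , D)   = block x-w
              (t′ , D′) = block w-y
          in _ , ser (at w) (subst (λ S → Block ts (at (to x)) (at w) (A (at (to x)) (at w)) S t) B≡pre D)
                            (subst (λ S → Block ts (at w) (at (to y)) S (B (at w) (at (to y))) t′) A≡out D′)
        new : ∃ (Block ts (at (to x)) (at (to y)) (A (at (to x)) (at (to y)) Subset.∪ A (at (to x)) (at w))
                                                  (B (at (to x)) (at (to y)) Subset.∪ B (at w) (at (to y))))
        new with nonempty? (A (at (to x)) (at (to y)))
        ... | yes ne = _ , par (disjoint (≢w y)) (proj₂ (block ne)) (proj₂ through)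
        -- If `A` has no tokens from `x` to `y`, neither has `B`, and both unions collapse to the
        -- new block.
        ... | no ¬ne
          rewrite Empty-unique ¬ne | Empty-unique (¬ne ∘ B⇒A {to x} {to y})
                | ∪-identityˡ (A (at (to x)) (at w)) | ∪-identityˡ (B (at w) (at (to y))) = through
        subst₂′ : ∀ {i j} → at (to x) ≡ i → at (to y) ≡ j →
          ∃ (Block ts (at (to x)) (at (to y)) (A (at (to x)) (at (to y)) Subset.∪ A (at (to x)) (at w))
                                              (B (at (to x)) (at (to y)) Subset.∪ B (at w) (at (to y)))) →
          ∃ (Block ts i j (A i j Subset.∪ A (at (to x)) (at w)) (B i j Subset.∪ B (at w) (at (to y))))
        subst₂′ refl refl D = D

    rewriting-covered : ∀ {G H} → Star _⇝_ G H → Covered G → Covered H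
    rewriting-covered ε               C = C
    rewriting-covered (inj₁ step ◅ r) C = rewriting-covered r (parallel-covered C step)
    rewriting-covered (inj₂ step ◅ r) C = rewriting-covered r (series-covered C step)

    single-edge-block : ∀ {G} → Covered G → IsSingleEdge G →
      ∃ (Block ts zero (fromℕ n) (out (τ zero)) (pre (τ (fromℕ n))))
    single-edge-block {G} C single = whole at-ι at-o (block ι-o)
      where
      open Graph G
      open Covered C
      open IsSingleEdge single
      ι-o : Nonempty (A (at ι) (at o))
      ι-o = Equivalence.to adjacent (label , Equivalence.from (only-edge _ _ _) (≈-refl , refl , ≈-refl))
      only : ∀ {i j} → Nonempty (A (at i) (at j)) → i ≈ ι × j ≈ o
      only ne = let (i≈ι , _ , j≈o) = Equivalence.to (only-edge _ _ _) (proj₂ (Equivalence.from adjacent ne))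
                in i≈ι , j≈o
      0≢n : at o ≢ zero
      0≢n e = ℕ.n≮0 (subst (λ k → at ι < k) e (Block-< (proj₂ (block ι-o))))
      A≡out : A (at ι) (at o) ≡ out (τ (at ι))
      A≡out = ⊆-antisym A⊆out λ p∈ →
        let (j , q) = produced p∈ in moveʳ A (at-cong (proj₂ (only (_ , q)))) q
      B≡pre : B (at ι) (at o) ≡ pre (τ (at o))
      B≡pre = ⊆-antisym B⊆pre λ p∈ →
        let (i , q) = consumed p∈ 0≢n in moveˡ B (at-cong (proj₁ (only (B⇒A (_ , q))))) q
      whole : ∀ {i j} → at ι ≡ i → at o ≡ j → ∃ (Block ts (at ι) (at o) (A (at ι) (at o)) (B (at ι) (at o))) →
              ∃ (Block ts i j (out (τ i)) (pre (τ j)))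
      whole refl refl (u , D) rewrite A≡out | B≡pre = u , D

    run-block : ∃ (Block ts zero (fromℕ n) (out (τ zero)) (pre (τ (fromℕ n))))
    run-block = let (_ , r , single) = series-parallel (_ , _ , accepting , ≅-refl)
                in single-edge-block (rewriting-covered r trace-covered) single

-- Subsets of places and finite sums of expressions

disjoint? : ∀ {n} (A B : Subset n) → Dec (Disjoint A B)
disjoint? A B = map′ (λ h {p} p∈A p∈B → h p (p∈A , p∈B)) (λ h p (p∈A , p∈B) → h p∈A p∈B)
  (Fin.all? (λ p → ¬? ((p ∈? A) ×-dec (p ∈? B))))

infix 4 _≟ˢ_

_≟ˢ_ : ∀ {n} (A B : Subset n) → Dec (A ≡ B)
_≟ˢ_ = ≡-dec Bool._≟_

subsets : ∀ n → List (Subset n)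
subsets ℕ.zero    = [] ∷ []
subsets (ℕ.suc n) = List.map (inside ∷_) (subsets n) List.++ List.map (outside ∷_) (subsets n)

∈-subsets : ∀ {n} (A : Subset n) → A ∈ subsets n
∈-subsets []            = here refl
∈-subsets (inside ∷ A)  = ∈-++⁺ˡ (∈-map⁺ (inside ∷_) (∈-subsets A))
∈-subsets {ℕ.suc n} (outside ∷ A) = ∈-++⁺ʳ (List.map (inside ∷_) (subsets n)) (∈-map⁺ (outside ∷_) (∈-subsets A))

∪-swap : ∀ {n} (A B C : Subset n) → A Subset.∪ (B Subset.∪ C) ≡ B Subset.∪ (A Subset.∪ C)
∪-swap A B C = trans (sym (∪-assoc A B C)) (trans (cong (Subset._∪ C) (∪-comm A B)) (∪-assoc B A C))

Disjoint-⊆ : ∀ {n} {A A′ B : Subset n} → A Subset.⊆ A′ → Disjoint A′ B → Disjoint A B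
Disjoint-⊆ sub h p∈A p∈B = h (sub p∈A) p∈B

Disjoint-sym : ∀ {n} {A B : Subset n} → Disjoint A B → Disjoint B A
Disjoint-sym h p∈B p∈A = h p∈A p∈B

module _ {n} {A B C : Subset n} where

  Disjoint-∪ : Disjoint A B → Disjoint A C → Disjoint A (B Subset.∪ C)
  Disjoint-∪ h h′ p∈A p∈ = case x∈p∪q⁻ B C p∈ of λ { (inj₁ q) → h p∈A q ; (inj₂ q) → h′ p∈A q }

  Disjoint-∪ˡ : Disjoint A (B Subset.∪ C) → Disjoint A B
  Disjoint-∪ˡ h p∈A p∈B = h p∈A (p⊆p∪q C p∈B)

  Disjoint-∪ʳ : Disjoint A (B Subset.∪ C) → Disjoint A C
  Disjoint-∪ʳ h p∈A p∈C = h p∈A (q⊆p∪q B C p∈C)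

∣∪∣-< : ∀ {n} {A C : Subset n} → Nonempty A → Disjoint A C → ∣ C ∣ ℕ.< ∣ A Subset.∪ C ∣
∣∪∣-< {A = A} {C} (p , p∈A) disj = p⊂q⇒∣p∣<∣q∣ (q⊆p∪q A C , p , p⊆p∪q C p∈A , disj p∈A)

⋁ : {I : Set} → List I → (I → Expr X) → Expr X
⋁ []       f = 𝟘
⋁ (i ∷ is) f = f i ∪ ⋁ is f

module _ {I : Set} (f : I → Expr X) {u : Term X} where

  T-⋁⁺ : ∀ {i is} → i ∈ is → T (f i) u → T (⋁ is f) u
  T-⋁⁺ (here refl) h = inj₁ h
  T-⋁⁺ (there i∈)  h = inj₂ (T-⋁⁺ i∈ h)

  T-⋁⁻ : ∀ is → T (⋁ is f) u → ∃ λ i → i ∈ is × T (f i) u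
  T-⋁⁻ (i ∷ is) (inj₁ h) = i , here refl , h
  T-⋁⁻ (i ∷ is) (inj₂ h) = let (j , j∈ , h′) = T-⋁⁻ is h in j , there j∈ , h′

when : {P : Set} → Dec P → Expr X → Expr X
when (yes _) e = e
when (no _)  e = 𝟘

module _ {P : Set} {e : Expr X} {u : Term X} where

  T-when⁺ : (P? : Dec P) → P → T e u → T (when P? e) u
  T-when⁺ (yes _) _ h = h
  T-when⁺ (no ¬p) p _ = contradiction p ¬p

  T-when⁻ : (P? : Dec P) → T (when P? e) u → P × T e u
  T-when⁻ (yes p) h = p , h

termExpr : Term X → Expr X
termExpr (var a) = var a
termExpr (u · v) = termExpr u · termExpr v
termExpr (u ∩ v) = termExpr u ∩ termExpr v
termExpr (u °)   = termExpr u °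
termExpr 𝟙       = 𝟙
termExpr ⊤       = ⊤

T-termExpr⁺ : (u : Term X) → T (termExpr u) u
T-termExpr⁺ (var a) = refl
T-termExpr⁺ (u · v) = u , v , T-termExpr⁺ u , T-termExpr⁺ v , refl
T-termExpr⁺ (u ∩ v) = u , v , T-termExpr⁺ u , T-termExpr⁺ v , refl
T-termExpr⁺ (u °)   = u , T-termExpr⁺ u , refl
T-termExpr⁺ 𝟙       = refl
T-termExpr⁺ ⊤       = refl

T-termExpr⁻ : (u : Term X) → ∀ {v} → T (termExpr u) v → v ≡ u
T-termExpr⁻ (var a) h = h
T-termExpr⁻ (u · v) (_ , _ , h , h′ , refl) with refl ← T-termExpr⁻ u h | refl ← T-termExpr⁻ v h′ = refl
T-termExpr⁻ (u ∩ v) (_ , _ , h , h′ , refl) with refl ← T-termExpr⁻ u h | refl ← T-termExpr⁻ v h′ = refl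
T-termExpr⁻ (u °)   (_ , h , refl) with refl ← T-termExpr⁻ u h = refl
T-termExpr⁻ 𝟙       h = h
T-termExpr⁻ ⊤       h = h

-- Flows and their realization by runs

module Flows {X : Set} (𝒜 : PetriAutomaton (Ext X)) where
  open PetriAutomaton 𝒜 
  open Tokens 𝒜
  open Blocks 𝒜

  private
    Trans : Set
    Trans = Transition (Ext X) #places

  -- A block without a run around it.

  data Flow : Trans → State → State → Term X → Set where
    atom : ∀ {t A} → Nonempty A → Flow t A A (edgesTerm (post t) A)
    ser  : ∀ {t A B u v t′} → t′ ∈ transitions → Flow t A (pre t′) u → Flow t′ (out t′) B v →
           Flow t A B (u · v)
    par  : ∀ {t A₁ A₂ B₁ B₂ u v} → Disjoint A₁ A₂ → Flow t A₁ B₁ u → Flow t A₂ B₂ v →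
           Flow t (A₁ Subset.∪ A₂) (B₁ Subset.∪ B₂) (u ∩ v)

  Block⇒Flow : ∀ {N} {ts : Vec Trans N} → (∀ i → lookup ts i ∈ transitions) →
               ∀ {x y A B u} → Block ts x y A B u → Flow (lookup ts x) A B u
  Block⇒Flow ∈ts (atom ne _)     = atom ne
  Block⇒Flow ∈ts (ser w D D′)    = ser (∈ts w) (Block⇒Flow ∈ts D) (Block⇒Flow ∈ts D′)
  Block⇒Flow ∈ts (par disj D D′) = par disj (Block⇒Flow ∈ts D) (Block⇒Flow ∈ts D′)

  data Steps : State → List Trans → State → Set where
    []  : ∀ {S} → Steps S [] S
    _∷_ : ∀ {S S′ t σ} → t ∈ transitions × Enabled t S → Steps (fire t S) σ S′ → Steps S (t ∷ σ) S′

  Steps-++ : ∀ {S S′ S″ σ σ′} → Steps S σ S′ → Steps S′ σ′ S″ → Steps S (σ List.++ σ′) S″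
  Steps-++ []       r = r
  Steps-++ (s ∷ r′) r = s ∷ Steps-++ r′ r

  Steps⇒Run : ∀ {S S′ σ} → Steps S σ S′ → Run S (fromList σ) S′
  Steps⇒Run []      = []
  Steps⇒Run (s ∷ r) = s ∷ Steps⇒Run r

  Reachable-Steps : ∀ {S S′ σ} → Reachable S → Steps S σ S′ → Reachable S′
  Reachable-Steps (_ , _ , r) s = _ , _ , Run-++ r (Steps⇒Run s)

  fire-∪ : ∀ t {C} → Disjoint (pre t) C → fire t (pre t Subset.∪ C) ≡ out t Subset.∪ C
  fire-∪ t {C} disj = ⊆-antisym
    (λ p∈ → case ∈-fire⁻ t (pre t Subset.∪ C) p∈ of λ
      { (inj₁ (q , p∉)) → case x∈p∪q⁻ (pre t) C q of λ
          { (inj₁ p∈pre) → contradiction p∈pre p∉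
          ; (inj₂ p∈C)   → q⊆p∪q (out t) C p∈C }
      ; (inj₂ q) → p⊆p∪q C q })
    (λ p∈ → case x∈p∪q⁻ (out t) C p∈ of λ
      { (inj₁ q) → x∈p∪q⁺ (inj₂ q)
      ; (inj₂ q) → ∈-fire⁺ t _ (q⊆p∪q (pre t) C q) (λ q′ → disj q′ q) })

  -- In the reachable state `pre t ∪ C` the tokens `C` survive the firing of `t`, and safety keeps
  -- its output off them.
  out-disjoint : ∀ {t C} → t ∈ transitions → Disjoint (pre t) C → Reachable (pre t Subset.∪ C) →
                 Disjoint (out t) C
  out-disjoint {t} {C} t∈ disj reach p∈out p∈C = safe reach t∈ (p⊆p∪q C)
    (_ , x∈p∩q⁺ (x∈p∧x∉q⇒x∈p─q (q⊆p∪q (pre t) C p∈C) (λ q → disj q p∈C) , p∈out))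

  Reachable-out : ∀ {t C} → t ∈ transitions → Disjoint (pre t) C → Reachable (pre t Subset.∪ C) →
                  Reachable (out t Subset.∪ C)
  Reachable-out {t} {C} t∈ disj reach = subst Reachable (fire-∪ t disj) (Reachable-fire reach t∈ (p⊆p∪q C))

  Avoids : State → List Trans → Set
  Avoids C σ = All (λ t → Disjoint C (pre t)) σ

  Avoids-⊆ : ∀ {C C′ σ} → C Subset.⊆ C′ → Avoids C′ σ → Avoids C σ
  Avoids-⊆ sub []        = []
  Avoids-⊆ sub (h ∷ av) = Disjoint-⊆ sub h ∷ Avoids-⊆ sub av

  -- Consecutive positions from `s` up to but excluding `e`. Bounds are natural numbers because `e`
  -- may lie one past the end of the run.
  data Occurs {N} (ts : Vec Trans N) : List Trans → ℕ → ℕ → Set where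
    []  : ∀ {s} → Occurs ts [] s s
    _∷_ : ∀ {t σ s e} → (∃ λ i → toℕ i ≡ s × lookup ts i ≡ t) → Occurs ts σ (ℕ.suc s) e →
          Occurs ts (t ∷ σ) s e

  Untouched : ∀ {N} → Vec Trans N → State → ℕ → ℕ → Set
  Untouched ts C s e = ∀ m → s ℕ.≤ toℕ m → toℕ m ℕ.< e → Disjoint C (pre (lookup ts m))

  module _ {N} (ts : Vec Trans N) where

    Occurs-++⁻ : ∀ σ {σ′ s e} → Occurs ts (σ List.++ σ′) s e →
                 ∃ λ m → Occurs ts σ s m × Occurs ts σ′ m e
    Occurs-++⁻ []      o       = _ , [] , o
    Occurs-++⁻ (t ∷ σ) (i ∷ o) = let (m , o₁ , o₂) = Occurs-++⁻ σ o in m , i ∷ o₁ , o₂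

    Occurs-≤ : ∀ {σ s e} → Occurs ts σ s e → s ℕ.≤ e
    Occurs-≤ []      = ℕ.≤-refl
    Occurs-≤ (_ ∷ o) = ℕ.≤-trans (ℕ.n≤1+n _) (Occurs-≤ o)

    Occurs-suc : ∀ {t σ s e} → Occurs ts σ s e → Occurs (t ∷ ts) σ (ℕ.suc s) (ℕ.suc e)
    Occurs-suc []                 = []
    Occurs-suc ((i , p , q) ∷ o) = (suc i , cong ℕ.suc p , q) ∷ Occurs-suc o

    Occurs-untouched : ∀ {C σ s e} → Avoids C σ → Occurs ts σ s e → Untouched ts C s e
    Occurs-untouched [] [] m s≤m m<e = contradiction s≤m (ℕ.<⇒≱ m<e)
    Occurs-untouched (disj ∷ av) ((i , refl , refl) ∷ o) m s≤m m<e with toℕ i ℕ.≟ toℕ m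
    ... | yes i≡m with refl ← Fin.toℕ-injective i≡m = disj
    ... | no i≢m  = Occurs-untouched av o m (ℕ.≤∧≢⇒< s≤m i≢m) m<e

    Untouched-++ : ∀ {C s m e} → Untouched ts C s m → Untouched ts C m e → Untouched ts C s e
    Untouched-++ {m = m} h h′ i s≤i i<e with toℕ i ℕ.<? m
    ... | yes i<m = h i s≤i i<m
    ... | no i≮m  = h′ i (ℕ.≮⇒≥ i≮m) i<e

    Untouched-empty : ∀ {C s e} → e ℕ.≤ s → Untouched ts C s e
    Untouched-empty e≤s m s≤m m<e = contradiction s≤m (ℕ.<⇒≱ (ℕ.<-≤-trans m<e e≤s))

  Occurs-fromList : ∀ σ → Occurs (fromList σ) σ 0 (length σ)
  Occurs-fromList []      = []
  Occurs-fromList (t ∷ σ) = (zero , refl , refl) ∷ Occurs-suc (fromList σ) (Occurs-fromList σ)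

  -- Firing σ realizes a flow next to the idle tokens C.  Wherever σ occurs in a
  -- run whose other transitions leave the tokens of the flow alone, it forms a block.

  record Realization (t : Trans) (A B : State) (u : Term X) (C : State) : Set where
    field
      σ        : List Trans
      steps    : Steps (A Subset.∪ C) σ (B Subset.∪ C)
      disjoint : Disjoint B C
      avoids   : Avoids C σ
      place    : ∀ {N} (ts : Vec Trans N) {x y s e} → lookup ts x ≡ t →
                 A Subset.⊆ out t → B Subset.⊆ pre (lookup ts y) →
                 toℕ x ℕ.< s → e ℕ.≤ toℕ y → Occurs ts σ s e →
                 Untouched ts A (ℕ.suc (toℕ x)) s → Untouched ts B e (toℕ y) →
                 Block ts x y A B u

  -- Reachability of the whole state, idle tokens included, is carried through the induction,
  -- because safety speaks only of reachable states.
  realize : ∀ {t A B u} → Flow t A B u → ∀ C → Disjoint A C → Reachable (A Subset.∪ C) →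
            Realization t A B u C
  realize {t} {A} (atom ne) C disj reach = record
    { σ = [] ; steps = [] ; disjoint = disj ; avoids = []
    ; place = place
    }
    where
    place : ∀ {N} (ts : Vec Trans N) {x y s e} → lookup ts x ≡ t →
            A Subset.⊆ out t → A Subset.⊆ pre (lookup ts y) →
            toℕ x ℕ.< s → e ℕ.≤ toℕ y → Occurs ts [] s e →
            Untouched ts A (ℕ.suc (toℕ x)) s → Untouched ts A e (toℕ y) →
            Block ts x y A A (edgesTerm (post t) A)
    place ts refl A⊆out A⊆pre x<s e≤y [] before after = atom ne λ p∈ →
      A⊆out p∈ , (ℕ.<-≤-trans x<s e≤y , A⊆pre p∈) , λ l (x<l , c) →
        -- Nothing takes the tokens between `x` and `y`, so `y` is their next consumer.
        ℕ.≮⇒≥ λ l<y → Untouched-++ ts before after l x<l l<y p∈ c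
  realize {t} {A} {B} (ser {u = u} {v} {t′} t′∈ f f′) C disj reach = record
    { σ        = R.σ List.++ t′ ∷ R′.σ
    ; steps    = Steps-++ R.steps ((t′∈ , p⊆p∪q C) ∷
                 subst (λ S → Steps S R′.σ (B Subset.∪ C)) (sym (fire-∪ t′ R.disjoint)) R′.steps)
    ; disjoint = R′.disjoint
    ; avoids   = ++⁺ R.avoids (Disjoint-sym R.disjoint ∷ R′.avoids)
    ; place    = place
    }
    where
    module R = Realization (realize f C disj reach)
    mid-reach : Reachable (pre t′ Subset.∪ C)
    mid-reach = Reachable-Steps reach R.steps
    module R′ = Realization (realize f′ C (out-disjoint t′∈ R.disjoint mid-reach)
                                          (Reachable-out t′∈ R.disjoint mid-reach))
    place : ∀ {N} (ts : Vec Trans N) {x y s e} → lookup ts x ≡ t →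
            A Subset.⊆ out t → B Subset.⊆ pre (lookup ts y) →
            toℕ x ℕ.< s → e ℕ.≤ toℕ y → Occurs ts (R.σ List.++ t′ ∷ R′.σ) s e →
            Untouched ts A (ℕ.suc (toℕ x)) s → Untouched ts B e (toℕ y) →
            Block ts x y A B (u · v)
    place ts t≡ A⊆out B⊆pre x<s e≤y o before after with Occurs-++⁻ ts R.σ o
    -- `t′` fires right after `R.σ` and right before `R′.σ`, so the waiting intervals around it are
    -- empty.
    ... | m , o₁ , ((w , refl , w≡) ∷ o₂) = ser w
      (subst (λ S → Block ts _ w A S u) (cong pre (sym w≡))
        (R.place ts t≡ A⊆out (λ p∈ → subst (λ t → _ Subset.∈ pre t) (sym w≡) p∈) x<s ℕ.≤-refl o₁ before
          (Untouched-empty ts ℕ.≤-refl)))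
      (subst (λ S → Block ts w _ S B v) (cong out (sym w≡))
        (R′.place ts w≡ ⊆-refl B⊆pre ℕ.≤-refl e≤y o₂ (Untouched-empty ts ℕ.≤-refl) after))
  -- The two flows fire one after the other: the first while `A₂` is idle, the second while `B₁` is
  -- idle. Avoiding idle tokens is what leaves `A₂` and `B₁` untouched in the meantime.
  realize {t} (par {A₁ = A₁} {A₂} {B₁} {B₂} {u} {v} disj₁₂ f f′) C disj reach = record
    { σ        = R.σ List.++ R′.σ
    ; steps    = Steps-++
        (subst (λ S → Steps S R.σ (A₂ Subset.∪ (B₁ Subset.∪ C))) (sym (∪-assoc A₁ A₂ C))
          (subst (Steps _ R.σ) (∪-swap B₁ A₂ C) R.steps))
        (subst (Steps (A₂ Subset.∪ (B₁ Subset.∪ C)) R′.σ)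
          (trans (∪-swap B₂ B₁ C) (sym (∪-assoc B₁ B₂ C))) R′.steps)
    ; disjoint = Disjoint-sym (Disjoint-∪ (Disjoint-sym (Disjoint-∪ʳ {B = A₂} R.disjoint))
                                          (Disjoint-sym (Disjoint-∪ʳ {B = B₁} R′.disjoint)))
    ; avoids   = ++⁺ (Avoids-⊆ (q⊆p∪q A₂ C) R.avoids)
                     (Avoids-⊆ (q⊆p∪q B₁ C) R′.avoids)
    ; place    = place
    }
    where
    module R = Realization (realize f (A₂ Subset.∪ C)
      (Disjoint-∪ disj₁₂ (λ p∈ → disj (p⊆p∪q A₂ p∈))) (subst Reachable (∪-assoc A₁ A₂ C) reach))
    module R′ = Realization (realize f′ (B₁ Subset.∪ C)
      (Disjoint-∪ (Disjoint-sym (Disjoint-∪ˡ {C = C} R.disjoint)) (λ p∈ → disj (q⊆p∪q A₁ A₂ p∈)))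
      (subst Reachable (∪-swap B₁ A₂ C) (Reachable-Steps (subst Reachable (∪-assoc A₁ A₂ C) reach) R.steps)))
    place : ∀ {N} (ts : Vec Trans N) {x y s e} → lookup ts x ≡ t →
            A₁ Subset.∪ A₂ Subset.⊆ out t → B₁ Subset.∪ B₂ Subset.⊆ pre (lookup ts y) →
            toℕ x ℕ.< s → e ℕ.≤ toℕ y → Occurs ts (R.σ List.++ R′.σ) s e →
            Untouched ts (A₁ Subset.∪ A₂) (ℕ.suc (toℕ x)) s → Untouched ts (B₁ Subset.∪ B₂) e (toℕ y) →
            Block ts x y (A₁ Subset.∪ A₂) (B₁ Subset.∪ B₂) (u ∩ v)
    place ts t≡ A⊆out B⊆pre x<s e≤y o before after with Occurs-++⁻ ts R.σ o
    ... | m , o₁ , o₂ = par disj₁₂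
      (R.place ts t≡ (A⊆out ∘ p⊆p∪q A₂) (B⊆pre ∘ p⊆p∪q B₂) x<s (ℕ.≤-trans (Occurs-≤ ts o₂) e≤y) o₁
        (λ i p q → Disjoint-⊆ (p⊆p∪q A₂) (before i p q))
        (Untouched-++ ts (Occurs-untouched ts (Avoids-⊆ (p⊆p∪q C) R′.avoids) o₂)
                      (λ i p q → Disjoint-⊆ (p⊆p∪q B₂) (after i p q))))
      (R′.place ts t≡ (A⊆out ∘ q⊆p∪q A₁ A₂) (B⊆pre ∘ q⊆p∪q B₁ B₂) (ℕ.<-≤-trans x<s (Occurs-≤ ts o₁)) e≤y o₂
        (Untouched-++ ts (λ i p q → Disjoint-⊆ (q⊆p∪q A₁ A₂) (before i p q))
                      (Occurs-untouched ts (Avoids-⊆ (p⊆p∪q C) R.avoids) o₁))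
        (λ i p q → Disjoint-⊆ (q⊆p∪q B₁ B₂) (after i p q)))

  Reachable-start : ∀ {t} → t ∈ transitions → pre t ≡ ⁅ ι ⁆ → Reachable (out t Subset.∪ Subset.⊥)
  Reachable-start {t} t∈ pre≡ = Reachable-out t∈ (λ _ → ∉⊥)
    (subst Reachable (trans (sym pre≡) (sym (∪-identityʳ (pre t)))) start-reachable)

  Flow⇒run : ∀ {t₀ tₙ u} → t₀ ∈ transitions → tₙ ∈ transitions → pre t₀ ≡ ⁅ ι ⁆ → out tₙ ≡ Subset.⊥ →
             Flow t₀ (out t₀) (pre tₙ) u →
             ∃₂ λ n (ts : Vec Trans (ℕ.suc n)) → Accepting ts ×
               Block ts zero (fromℕ n) (out (lookup ts zero)) (pre (lookup ts (fromℕ n))) u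
  Flow⇒run {t₀} {tₙ} {u} t₀∈ tₙ∈ pre≡ out≡ f =
    length ρ , ts , Steps⇒Run run , blk (Occurs-++⁻ ts R.σ (Occurs-suc (fromList ρ) (Occurs-fromList ρ)))
    where
    module R = Realization (realize f Subset.⊥ (λ _ → ∉⊥) (Reachable-start t₀∈ pre≡))
    ρ : List Trans
    ρ = R.σ List.++ tₙ ∷ []
    ts : Vec Trans (ℕ.suc (length ρ))
    ts = t₀ ∷ fromList ρ
    run : Steps ⁅ ι ⁆ (t₀ ∷ ρ) Subset.⊥
    run = (t₀∈ , subst (pre t₀ Subset.⊆_) pre≡ ⊆-refl)
      ∷ subst (λ S → Steps S ρ Subset.⊥)
          (trans (sym (fire-∪ t₀ (λ _ → ∉⊥))) (cong (fire t₀) (trans (∪-identityʳ (pre t₀)) pre≡)))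
          (Steps-++ R.steps ((tₙ∈ , p⊆p∪q Subset.⊥) ∷
            subst (λ S → Steps S [] Subset.⊥)
              (sym (trans (fire-∪ tₙ (λ _ → ∉⊥)) (trans (∪-identityʳ (out tₙ)) out≡))) []))
    blk : ∃ (λ m → Occurs ts R.σ 1 m × Occurs ts (tₙ ∷ []) m (ℕ.suc (length ρ))) →
          Block ts zero (fromℕ (length ρ)) (out t₀) (pre (lookup ts (fromℕ (length ρ)))) u
    -- The empty remainder forces `m` to be `length ρ`, so `tₙ` stands at the last position.
    blk (m , o , ((i , i≡m , i≡) ∷ []))
      with refl ← Fin.toℕ-injective {i = i} (trans i≡m (sym (Fin.toℕ-fromℕ m))) =
      subst (λ S → Block ts zero i (out t₀) S u) (cong pre (sym i≡))
        (R.place ts {x = zero} refl ⊆-refl (λ p∈ → subst (λ t → _ Subset.∈ pre t) (sym i≡) p∈)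
          z<s (ℕ.≤-reflexive (sym i≡m)) o (Untouched-empty ts ℕ.≤-refl)
          (Untouched-empty ts (ℕ.≤-reflexive i≡m)))

-- The expression of an automaton

module Expressions {X : Set} (𝒜 : PetriAutomaton (Ext X)) where
  open PetriAutomaton 𝒜
  open Tokens 𝒜
  open Blocks 𝒜
  open Flows 𝒜

  private
    Trans : Set
    Trans = Transition (Ext X) #places

    Family : Set
    Family = Trans → State → State → Expr X

  -- Kleene's construction: the flows composed in series of flows in c, with
  -- the transitions in between taken from the list.

  series : Family → List Trans → Family
  series c []       t A B = c t A B
  series c (q ∷ qs) t A B =
    -- Leaving `q` at once and leaving it after loops are separate summands: a factor `𝟙 ∪ e ⁺`
    -- would produce terms with a factor `𝟙`, which belong to no flow.
    s t A B ∪ s t A (pre q) · (s q (out q) B ∪ s q (out q) (pre q) ⁺ · s q (out q) B)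
    where
    s : Family
    s = series c qs

  atoms : Family
  atoms t A B = when (nonempty? A ×-dec A ≟ˢ B) (termExpr (edgesTerm (post t) A))

  Split : Set
  Split = (State × State) × (State × State)

  splits : List Split
  splits = cartesianProduct (cartesianProduct (subsets _) (subsets _))
                            (cartesianProduct (subsets _) (subsets _))

  ∈-splits : ∀ s → s ∈ splits
  ∈-splits ((A₁ , A₂) , (B₁ , B₂)) = ∈-cartesianProduct⁺
    (∈-cartesianProduct⁺ (∈-subsets A₁) (∈-subsets A₂))
    (∈-cartesianProduct⁺ (∈-subsets B₁) (∈-subsets B₂))

  split? : ∀ (A B : State) (((A₁ , A₂) , (B₁ , B₂)) : Split) →
           Dec (A ≡ A₁ Subset.∪ A₂ × B ≡ B₁ Subset.∪ B₂ × Disjoint A₁ A₂)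
  split? A B ((A₁ , A₂) , (B₁ , B₂)) =
    A ≟ˢ A₁ Subset.∪ A₂ ×-dec B ≟ˢ B₁ Subset.∪ B₂ ×-dec disjoint? A₁ A₂

  parallel : (State → State → Expr X) → State → State → Split → Expr X
  parallel e A B s@((A₁ , A₂) , (B₁ , B₂)) = when (split? A B s) (e A₁ B₁ ∩ e A₂ B₂)

  -- The flows that are not composed in series, of parallel depth at most d.

  components : ℕ → Family
  parallels  : ℕ → Family
  components d t A B = atoms t A B ∪ parallels d t A B
  parallels ℕ.zero    t A B = 𝟘
  parallels (ℕ.suc d) t A B =
    ⋁ splits (parallel (series (components d) transitions t) A B)

  flows : ℕ → Family
  flows d = series (components d) transitions

  -- An accepting run starts with a transition that takes exactly `ι` and ends with one that
  -- produces nothing.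
  ends? : ∀ (ends : Trans × Trans) → Dec (pre (proj₁ ends) ≡ ⁅ ι ⁆ × out (proj₂ ends) ≡ Subset.⊥)
  ends? (t₀ , tₙ) = pre t₀ ≟ˢ ⁅ ι ⁆ ×-dec out tₙ ≟ˢ Subset.⊥

  between : Trans × Trans → Expr X
  between ends@(t₀ , tₙ) = when (ends? ends) (flows #places t₀ (out t₀) (pre tₙ))

  automatonExpr : Expr X
  automatonExpr = ⋁ (cartesianProduct transitions transitions) between

  -- Soundness: terms of the expression belong to flows

  Sound : Family → Set
  Sound c = ∀ {t A B u} → T (c t A B) u → Flow t A B u

  series-sound : ∀ {c} → Sound c → ∀ qs → All (_∈ transitions) qs → Sound (series c qs)
  series-sound sound [] _ h = sound h
  series-sound {c} sound (q ∷ qs) (q∈ ∷ qs∈) h = case h of λ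
    { (inj₁ h₁) → IH h₁
    ; (inj₂ (_ , _ , h₁ , inj₁ h₂ , refl)) → ser q∈ (IH h₁) (IH h₂)
    ; (inj₂ (_ , _ , h₁ , inj₂ (_ , _ , (_ , h′ ∷ hs , refl) , h₂ , refl) , refl)) →
        ser q∈ (IH h₁) (ser q∈ (loops h′ hs) (IH h₂)) }
    where
    IH : Sound (series c qs)
    IH = series-sound sound qs qs∈
    loops : ∀ {u us} → T (series c qs q (out q) (pre q)) u → All (T (series c qs q (out q) (pre q))) us →
            Flow q (out q) (pre q) (foldr₁ _·_ (u ∷ us))
    loops h []        = IH h
    loops h (h′ ∷ hs) = ser q∈ (IH h) (loops h′ hs)

  components-sound : ∀ d → Sound (components d)
  components-sound d {t} {A} {B} (inj₁ h) with T-when⁻ (nonempty? A ×-dec A ≟ˢ B) h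
  ... | (ne , refl) , h′ with refl ← T-termExpr⁻ (edgesTerm (post t) A) h′ = atom ne
  components-sound (ℕ.suc d) {t} {A} {B} (inj₂ h)
    with T-⋁⁻ (parallel (series (components d) transitions t) A B) splits h
  ... | s , _ , h′ with T-when⁻ (split? A B s) h′
  ... | (refl , refl , disj) , _ , _ , h₁ , h₂ , refl =
    par disj (series-sound (components-sound d) transitions all∈ h₁)
             (series-sound (components-sound d) transitions all∈ h₂)
    where
    all∈ : All (_∈ transitions) transitions
    all∈ = All.tabulate id

  flows-sound : ∀ d → Sound (flows d)
  flows-sound d = series-sound (components-sound d) transitions (All.tabulate id)

  -- Completeness: bracketing a block along Kleene's construction

  module Complete {N} (ts : Vec Trans N) where

    private
      τ : Fin N → Trans
      τ = lookup ts

    ser-at : ∀ {w q x y A B u v} → τ w ≡ q → Block ts x w A (pre q) u → Block ts w y (out q) B v →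
             Block ts x y A B (u · v)
    ser-at refl = ser _

    Has : Expr X → Fin N → Fin N → State → State → Set
    Has e x y A B = ∃ λ u → T e u × Block ts x y A B u

    Placement : Set₁
    Placement = Fin N → Fin N → State → State → Set

    data Visits (P : Placement) (q : Trans) (y : Fin N) (B : State) : Fin N → Set where
      last : ∀ {w} → P w y (out q) B → Visits P q y B w
      next : ∀ {w w′} → P w w′ (out q) (pre q) → τ w′ ≡ q → Visits P q y B w′ → Visits P q y B w

    -- Follows the recursion of `series` with positions of `ts` for the inner transitions, so that
    -- repeated firings of one transition are told apart.
    Placed : Family → List Trans → Placement
    Placed c []       x y A B = Has (c (τ x) A B) x y A B
    Placed c (q ∷ qs) x y A B =
      Placed c qs x y A B ⊎
      ∃ λ w → τ w ≡ q × Placed c qs x w A (pre q) × Visits (Placed c qs) q y B w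

    module _ {c : Family} where

      Placed⇒Has : ∀ qs {x y A B} → Placed c qs x y A B → Has (series c qs (τ x) A B) x y A B
      -- Gathers the loops at `q` into one list for `⁺`. That list must be nonempty, hence the first
      -- alternative for no loop at all.
      Visits⇒Has : ∀ q qs {w y B} → τ w ≡ q → Visits (Placed c qs) q y B w →
        Has (series c qs q (out q) B) w y (out q) B ⊎
        (∃ λ w′ → τ w′ ≡ q ×
          (∃ λ us → All⁺.All (T (series c qs q (out q) (pre q))) us ×
                    Block ts w w′ (out q) (pre q) (foldr₁ _·_ us)) ×
          Has (series c qs q (out q) B) w′ y (out q) B)

      Placed⇒Has [] h = h
      Placed⇒Has (q ∷ qs) (inj₁ p) = let (u , h , D) = Placed⇒Has qs p in u , inj₁ h , D
      Placed⇒Has (q ∷ qs) (inj₂ (w , refl , p , visits))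
        with Placed⇒Has qs p | Visits⇒Has q qs refl visits
      ... | u , h , D | inj₁ (v , h′ , D′) = u · v , inj₂ (u , v , h , inj₁ h′ , refl) , ser w D D′
      ... | u , h , D | inj₂ (w′ , w′≡ , (us , hs , E) , v , h′ , D′) =
        u · (foldr₁ _·_ us · v)
        , inj₂ (u , _ , h , inj₂ (_ , v , (us , hs , refl) , h′ , refl) , refl)
        , ser w D (ser-at w′≡ E D′)

      Visits⇒Has q qs refl (last p) = inj₁ (Placed⇒Has qs p)
      Visits⇒Has q qs refl (next {w′ = w′} p w′≡ visits)
        with Placed⇒Has qs p | Visits⇒Has q qs w′≡ visits
      ... | u , h , D | inj₁ end = inj₂ (w′ , w′≡ , (u ∷ [] , h ∷ [] , D) , end)
      ... | u , h , D | inj₂ (w″ , w″≡ , (u′ ∷ us , (h′ ∷ hs) , E) , end) =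
        inj₂ (w″ , w″≡ , (u ∷ u′ ∷ us , h ∷ h′ ∷ hs , ser-at w′≡ D E) , end)

      placed-one : ∀ qs {x y A B} → Has (c (τ x) A B) x y A B → Placed c qs x y A B
      placed-one []       h = h
      placed-one (q ∷ qs) h = inj₁ (placed-one qs h)

      -- At the level of `τ w` the new joint becomes the first visit, before any visits already
      -- there; at the levels above it only lengthens the stretch before the first visit.
      placed-cons : ∀ {qs x y A B} w → τ w ∈ qs → Has (c (τ x) A (pre (τ w))) x w A (pre (τ w)) →
                    Placed c qs w y (out (τ w)) B → Placed c qs x y A B
      placed-cons {q ∷ qs} w (here refl) h (inj₁ p) = inj₂ (w , refl , placed-one qs h , last p)
      placed-cons {q ∷ qs} w (here refl) h (inj₂ (w′ , w′≡ , p , visits)) =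
        inj₂ (w , refl , placed-one qs h , next p w′≡ visits)
      placed-cons {q ∷ qs} w (there w∈) h (inj₁ p) = inj₁ (placed-cons w w∈ h p)
      placed-cons {q ∷ qs} w (there w∈) h (inj₂ (w′ , w′≡ , p , visits)) =
        inj₂ (w′ , w′≡ , placed-cons w w∈ h p , visits)

      -- A series as a list of its components: the brackets of the block are forgotten here and put
      -- back by `Placed⇒Has` as the expression demands.
      data Path (x y : Fin N) (A B : State) : Set where
        one  : Has (c (τ x) A B) x y A B → Path x y A B
        cons : ∀ w → Has (c (τ x) A (pre (τ w))) x w A (pre (τ w)) → Path w y (out (τ w)) B → Path x y A B

      Path-++ : ∀ {x y A B} w → Path x w A (pre (τ w)) → Path w y (out (τ w)) B → Path x y A B
      Path-++ w (one h)       π = cons w h π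
      Path-++ w (cons w′ h π) π′ = cons w′ h (Path-++ w π π′)

      Path⇒Has : (∀ w → τ w ∈ transitions) → ∀ {x y A B} → Path x y A B →
                 Has (series c transitions (τ x) A B) x y A B
      Path⇒Has ∈ts π = Placed⇒Has transitions (go π)
        where
        go : ∀ {x y A B} → Path x y A B → Placed c transitions x y A B
        go (one h)      = placed-one transitions h
        go (cons w h π) = placed-cons w (∈ts w) h (go π)

    -- The idle tokens C grow with the parallel depth, which therefore stays
    -- below the number of places.

    flatten : (∀ w → τ w ∈ transitions) → ∀ d C {x y A B u} → Block ts x y A B u → Disjoint A C →
              Reachable (A Subset.∪ C) → #places ℕ.≤ ∣ C ∣ ℕ.+ d → Path {components d} x y A B
    flatten ∈ts d C {A = A} D@(atom {x} {y} ne toks) disj reach bound = one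
      (_ , inj₁ (T-when⁺ (nonempty? A ×-dec A ≟ˢ A) (ne , refl) (T-termExpr⁺ _)) , atom ne toks)
    -- Series costs no depth. The realization of the first half shows that `pre (τ w) ∪ C` is
    -- reachable, although `ts` itself need not pass through that state.
    flatten ∈ts d C (ser w D D′) disj reach bound = Path-++ w
      (flatten ∈ts d C D disj reach bound)
      (flatten ∈ts d C D′ (out-disjoint (∈ts w) R.disjoint mid) (Reachable-out (∈ts w) R.disjoint mid) bound)
      where
      module R = Realization (realize (Block⇒Flow ∈ts D) C disj reach)
      mid : Reachable (pre (τ w) Subset.∪ C)
      mid = Reachable-Steps reach R.steps
    -- With no depth left `C` fills all places, yet the block carries a token outside `C`.
    flatten ∈ts ℕ.zero C {A = A} D@(par _ _ _) disj reach bound = contradiction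
      (ℕ.≤-trans (∣∪∣-< (Block-nonempty D) disj) (∣p∣≤n (A Subset.∪ C)))
      (ℕ.≤⇒≯ (subst (#places ℕ.≤_) (ℕ.+-identityʳ ∣ C ∣) bound))
    -- Each side counts the starting tokens of the other as idle; these are at least one more, which
    -- pays for the decrease of `d`.
    flatten ∈ts (ℕ.suc d) C {x} {y} (par {A₁ = A₁} {A₂} {B₁} {B₂} disj₁₂ D₁ D₂) disj reach bound =
      let (u , h , E)  = Path⇒Has ∈ts (flatten ∈ts d (A₂ Subset.∪ C) D₁
                           (Disjoint-∪ disj₁₂ (λ p∈ → disj (p⊆p∪q A₂ p∈)))
                           (subst Reachable (∪-assoc A₁ A₂ C) reach)
                           (larger D₂ (λ p∈ → disj (q⊆p∪q A₁ A₂ p∈))))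
          (v , h′ , E′) = Path⇒Has ∈ts (flatten ∈ts d (A₁ Subset.∪ C) D₂
                           (Disjoint-∪ (Disjoint-sym disj₁₂) (λ p∈ → disj (q⊆p∪q A₁ A₂ p∈)))
                           (subst Reachable (trans (∪-assoc A₁ A₂ C) (∪-swap A₁ A₂ C)) reach)
                           (larger D₁ (λ p∈ → disj (p⊆p∪q A₂ p∈))))
      in one (u ∩ v
        , inj₂ (T-⋁⁺ (parallel (flows d (τ x)) (A₁ Subset.∪ A₂) (B₁ Subset.∪ B₂)) (∈-splits s)
            (T-when⁺ (split? _ _ s) (refl , refl , disj₁₂) (u , v , h , h′ , refl)))
        , par disj₁₂ E E′)
      where
      s : Split
      s = (A₁ , A₂) , (B₁ , B₂)
      larger : ∀ {A B u} → Block ts x y A B u → Disjoint A C → #places ℕ.≤ ∣ A Subset.∪ C ∣ ℕ.+ d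
      larger {A} D disj = ℕ.≤-trans bound (subst (ℕ._≤ ∣ A Subset.∪ C ∣ ℕ.+ d) (sym (ℕ.+-suc ∣ C ∣ d))
        (ℕ.+-monoˡ-≤ d (∣∪∣-< (Block-nonempty D) disj)))

-- Equality of the two sets of graphs

module _ {X : Set} (𝒜 : PetriAutomaton (Ext X)) where
  open PetriAutomaton 𝒜
  open Tokens 𝒜
  open Blocks 𝒜
  open Flows 𝒜
  open Elimination 𝒜
  open Expressions 𝒜

  automaton-regular : overlines traces ≐ 𝒢 automatonExpr
  automaton-regular = sub , sup
    where
    sub : ∀ {H} → overlines traces H → 𝒢 automatonExpr H
    sub {H} (G , (n , ts , run , G≅) , H≅) =
      -- `D` has the term found by rewriting; `D′` spans the same run with a term of the expression.
      let (u , D)      = run-block run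
          (v , h , D′) = Complete.Path⇒Has ts ∈ts
            (Complete.flatten ts ∈ts #places Subset.⊥ D (λ _ → ∉⊥) (Reachable-start (∈ts zero) pre≡)
              (ℕ.m≤n+m #places _))
      in v
       , T-⋁⁺ between (∈-cartesianProduct⁺ (∈ts zero) (∈ts (fromℕ n)))
           (T-when⁺ (ends? (lookup ts zero , lookup ts (fromℕ n))) (pre≡ , out≡) h)
       , ≅-trans H≅ (≅-trans (overline-cong G≅) (Block⇒≅ run D′))
      where
      ∈ts : ∀ w → lookup ts w ∈ transitions
      ∈ts = Run⇒∈ run
      pre≡ : pre (lookup ts zero) ≡ ⁅ ι ⁆
      pre≡ = ⊆-antisym (first-enabled run)
        (λ p∈ → subst (Subset._∈ _) (sym (x∈⁅y⁆⇒x≡y ι p∈)) (pre-first run))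
        where
        first-enabled : ∀ {S S′} {ts : Vec _ (ℕ.suc n)} → Run S ts S′ → pre (lookup ts zero) Subset.⊆ S
        first-enabled ((_ , en) ∷ _) = en
      out≡ : out (lookup ts (fromℕ n)) ≡ Subset.⊥
      -- A token produced by the last transition would need a consumer after it.
      out≡ = Empty-unique λ (p , p∈) → let (l , (n<l , _) , _) = consumer-exists run (fromℕ n) p∈ in
        ℕ.≤⇒≯ (Fin.≤fromℕ l) n<l
    sup : ∀ {H} → 𝒢 automatonExpr H → overlines traces H
    sup {H} (u , h , H≅) with T-⋁⁻ between (cartesianProduct transitions transitions) h
    ... | ends , ends∈ , h′ with T-when⁻ (ends? ends) h′ | ∈-cartesianProduct⁻ transitions transitions ends∈
    ... | (pre≡ , out≡) , h″ | t₀∈ , tₙ∈ with Flow⇒run t₀∈ tₙ∈ pre≡ out≡ (flows-sound #places h″)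
    ... | n , ts , run , D = trace ts , (n , ts , run , ≅-refl) , ≅-trans H≅ (≅-sym (Block⇒≅ run D))

theorem7p30 : ∀ {ℓ} (X : Set) (S : Pred (Graph X) ℓ) → Recognisable S → Regular S
theorem7p30 X S (𝒜 , S⊆ , ⊆S) =
  let (sub , sup) = automaton-regular 𝒜
  in Expressions.automatonExpr 𝒜 , (λ s → sub (S⊆ s)) , (λ g → ⊆S (sup g))
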